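{- Let $r\ge 2$ and $1\le q\le r$ be integers. Suppose that we are given positive reals $t_1,\dots,t_q$ and positive integers $s_1,\dots,s_r,t_{q+1},\dots,t_r$ such that $t_i\ge s_i$ for all $i\in\{q+1,\dots,r\}$. Let $$\mathbf F=(\mathbf k_{s_1,t_1},\dots,\mathbf k_{s_q,t_q},K_{s_{q+1},t_{q+1}},\dots,K_{s_r,t_r}).$$ Then there exist a positive integer $s$ and a real $t>0$ such that $\mathbf k_{s,t}\to\mathbf F$ and $\hat r(\mathbf F)=e(\mathbf k_{s,t})=st$.
   Context: Notation: $[r]=\{1,\dots,r\}$; $2^X$ is the set of all subsets of $X$; $\subset$ allows equality. All graphs are finite and simple; $K_{m,n}$ is the complete bipartite graph with parts of sizes $m$ and $n$. Weights. A weight $\mathbf f$ on a finite nonempty set $V(\mathbf f)$ is a family $(f_A)_{A\in 2^{V(\mathbf f)}}$ of non-negative reals. Its order is $v(\mathbf f)=|V(\mathbf f)|$ and its size is $e(\mathbf f)=\sum_{A} f_A|A|$. For a positive integer $s$ and real $t>0$, $\mathbf k_{s,t}$ is the weight on $[s]$ which has value $t$ on the set $[s]$ and value $0$ on every other subset of $[s]$. Containment of a graph in a weight. For a bipartite graph $F$ and a weight $\mathbf g$, $F\subset\mathbf g$ means that for some bipartition $V(F)=V_1(F)\cup V_2(F)$ there is an injection $h:V_1(F)\to V(\mathbf g)$ such that for any $A\subset V_1(F)$ dominated by a vertex of $V_2(F)$ (i.e. $A\subset\Gamma_F(y)$ for some $y\in V_2(F)$, where $\Gamma_F(y)$ is the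 neighbourhood of $y$) there is $B\subset V(\mathbf g)$ with $h(A)\subset B$ and $g_B>0$. Containment of weights. For weights $\mathbf f,\mathbf g$ (if $v(\mathbf f)>v(\mathbf g)$, first enlarge $V(\mathbf g)$ by new vertices, letting $\mathbf g$ be zero on all new sets), $\mathbf f\subset\mathbf g$ means that there are an injection $h:V(\mathbf f)\to V(\mathbf g)$ and reals $w_{AB}\ge0$ ($A\in2^{V(\mathbf f)}$, $B\in2^{V(\mathbf g)}$) such that $w_{AB}=0$ whenever $h(A)\not\subset B$; $\sum_{B\supset h(A)}w_{AB}\ge f_A$ for all $A$; and $\sum_{A:\,h(A)\subset B}w_{AB}\le g_B$ for all $B$. Colourings of weights. An $r$-colouring $\mathbf c$ of a weight $\mathbf g$ is a family $(c_{A_1,\dots,A_r})$ of non-negative reals indexed by $r$-tuples of pairwise disjoint subsets of $V(\mathbf g)$ such that $\sum_{A_1\cup\dots\cup A_r=A}c_{A_1,\dots,A_r}>g_A$ for all $A\in2^{V(\mathbf g)}$. Its $i$-th colour subweight $\mathbf c_i$ is the weight on $V(\mathbf g)$ with $c_{i,A}=\sum_{(A_1,\dots,A_r):\,A_i=A}c_{A_1,\dots,A_r}$. Arrowing for weights. For $\mathbf F=(\mathbf F_1,\dots,\mathbf F_r)$, with $\mathbf F_i$ a weight for $i\le q$ and a bipartite graph for $i>q$, $\mathbf g\to\mathbf F$ means that for every $r$-colouring $\mathbf c$ of $\mathbf g$ we have $\mathbf F_i\subset\mathbf c_i$ for some $i\in[r]$. Finally $\hat r(\mathbf F)=\inf\{e(\mathbf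 g):\mathbf g\text{ is a weight},\ \mathbf g\to\mathbf F\}$. -}

module Defs where

open import Algebra.Bundles using (CommutativeRing)
open import Algebra.Structures using (IsCommutativeRing)
import Algebra.Definitions.RawMonoid as RawMonoid
open import Data.Bool.Base using (Bool; true; false; if_then_else_)
import Data.Bool.Properties as Bool
open import Data.Fin.Base using (Fin; toℕ; _↑ˡ_; _↑ʳ_)
open import Data.Fin.Properties using (all?)
open import Data.Fin.Subset
  using (Subset; inside; outside; _∈_; _∉_; _⊆_; _∩_; ⋃; ∣_∣; Nonempty; Empty; ⊤)
open import Data.Fin.Subset.Properties using (_∈?_; nonempty?)
open import Data.List.Base as List using (List; []; _∷_; cartesianProductWith; filter; foldr)
open import Data.List.Relation.Unary.All as All using (All; []; _∷_)
import Data.List.Relation.Unary.All.Properties as All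
open import Data.Nat.Base as ℕ using (ℕ; zero; suc; _∸_)
import Data.Nat.Properties as ℕ
open import Data.Product.Base using (Σ; ∃; ∃-syntax; _×_; _,_; proj₁; proj₂)
open import Data.Sum.Base using (_⊎_; inj₁; inj₂)
open import Data.Vec.Base as Vec using (Vec; []; _∷_; lookup; tabulate; toList)
open import Data.Vec.Properties using (≡-dec; lookup⇒[]=; []=⇒lookup; lookup∘tabulate)
import Data.Vec.Functional as F
open import Data.Vec.Relation.Unary.AllPairs using (AllPairs; allPairs?)
open import Function.Base using (_∘_)
open import Function.Definitions using (Injective)
open import Level using (0ℓ)
open import Relation.Binary.Core using (Rel)
open import Relation.Binary.Definitions using (Symmetric; DecidableEquality)
open import Relation.Binary.PropositionalEquality using (_≡_; sym; trans)
open import Relation.Binary.Structures using (IsTotalOrder)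
import Relation.Binary.Construct.NonStrictToStrict as NonStrictToStrict
open import Relation.Nullary using (¬_; Dec; does)
open import Relation.Nullary.Decidable using (¬?; _→-dec_; dec-true; dec-false)
open import Relation.Unary using (Pred; Satisfiable)

module Bounds {A : Set} (_≤_ : Rel A 0ℓ) where

  IsUpperBound IsLowerBound IsSupremum IsInfimum : Pred A 0ℓ → Pred A 0ℓ
  IsUpperBound P u = ∀ {x} → P x → x ≤ u
  IsLowerBound P l = ∀ {x} → P x → l ≤ x
  IsSupremum   P s = IsUpperBound P s × (∀ {u} → IsUpperBound P u → s ≤ u)
  IsInfimum    P i = IsLowerBound P i × (∀ {l} → IsLowerBound P l → l ≤ i)

-- The real numbers, given by their characterisation up to isomorphism as a
-- Dedekind-complete totally ordered field.

record CompleteOrderedField : Set₁ where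
  infix  4 _≈_ _≤_
  infixl 6 _+_
  infixl 7 _*_
  field
    Carrier           : Set
    _≈_ _≤_           : Rel Carrier 0ℓ
    _+_ _*_           : Carrier → Carrier → Carrier
    -_                : Carrier → Carrier
    0# 1#             : Carrier
    isCommutativeRing : IsCommutativeRing _≈_ _+_ _*_ -_ 0# 1#
    0≉1               : ¬ (0# ≈ 1#)
    inverse           : ∀ x → ¬ (x ≈ 0#) → ∃[ y ] x * y ≈ 1#
    isTotalOrder      : IsTotalOrder _≈_ _≤_
    +-monoˡ-≤         : ∀ z {x y} → x ≤ y → x + z ≤ y + z
    *-nonNeg          : ∀ {x y} → 0# ≤ x → 0# ≤ y → 0# ≤ x * y

  open Bounds _≤_ public

  field
    complete : ∀ (P : Pred Carrier 0ℓ) →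
               Satisfiable P → Satisfiable (IsUpperBound P) → Satisfiable (IsSupremum P)

  commutativeRing : CommutativeRing 0ℓ 0ℓ
  commutativeRing = record { isCommutativeRing = isCommutativeRing }

  open NonStrictToStrict _≈_ _≤_ public using (_<_)
  open CommutativeRing commutativeRing public using (+-rawMonoid)
  open RawMonoid +-rawMonoid public using () renaming (_×_ to infixr 8 _·_)

-- Vertex sets of graphs and weights are taken to be Fin n.

vectors : ∀ {A : Set} → List A → ∀ n → List (Vec A n)
vectors xs zero    = [] ∷ []
vectors xs (suc n) = cartesianProductWith _∷_ xs (vectors xs n)

subsets : ∀ n → List (Subset n)
subsets = vectors (outside ∷ inside ∷ [])

_≟_ : ∀ {n} → DecidableEquality (Subset n)
_≟_ = ≡-dec Bool._≟_

-- h [ A ]⊆ B says that h(A) ⊆ B.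

_[_]⊆_ : ∀ {m n} → (Fin m → Fin n) → Subset m → Subset n → Set
h [ A ]⊆ B = ∀ x → x ∈ A → h x ∈ B

_[_]⊆?_ : ∀ {m n} (h : Fin m → Fin n) A B → Dec (h [ A ]⊆ B)
h [ A ]⊆? B = all? λ x → (x ∈? A) →-dec (h x ∈? B)

Disjoint : ∀ {n} → Rel (Subset n) 0ℓ
Disjoint A B = Empty (A ∩ B)

PairwiseDisjoint : ∀ {n r} → Pred (Vec (Subset n) r) 0ℓ
PairwiseDisjoint = AllPairs Disjoint

disjointTuples : ∀ n r → List (Vec (Subset n) r)
disjointTuples n r =
  filter (allPairs? λ A B → ¬? (nonempty? (A ∩ B))) (vectors (subsets n) r)

record Graph : Set₁ where
  field
    order   : ℕ
    Adj     : Rel (Fin order) 0ℓ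
    symm    : Symmetric Adj
    irrefl  : ∀ {x} → ¬ Adj x x

-- IsBipartition G V₁ says that V₁ and its complement form a bipartition of G.

IsBipartition : (G : Graph) → Subset (Graph.order G) → Set
IsBipartition G V₁ = ∀ {x y} → Adj x y → (x ∈ V₁ × y ∉ V₁) ⊎ (x ∉ V₁ × y ∈ V₁)
  where open Graph G

record BipartiteGraph : Set₁ where
  field
    graph     : Graph
    bipartite : ∃ (IsBipartition graph)
  open Graph graph public

K : ℕ → ℕ → BipartiteGraph
K m n = record { graph = G ; bipartite = V₁ , split }
  where
  Left : Pred (Fin (m ℕ.+ n)) 0ℓ
  Left x = toℕ x ℕ.< m

  Left? : ∀ x → Dec (Left x)
  Left? x = toℕ x ℕ.<? m

  G : Graph
  G = record
    { order  = m ℕ.+ n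
    ; Adj    = λ x y → (Left x × ¬ Left y) ⊎ (¬ Left x × Left y)
    ; symm   = λ { (inj₁ (p , q)) → inj₂ (q , p) ; (inj₂ (p , q)) → inj₁ (q , p) }
    ; irrefl = λ { (inj₁ (p , q)) → q p ; (inj₂ (p , q)) → p q }
    }

  V₁ : Subset (m ℕ.+ n)
  V₁ = tabulate (does ∘ Left?)

  in-V₁ : ∀ {x} → Left x → x ∈ V₁
  in-V₁ {x} p = lookup⇒[]= x V₁ (trans (lookup∘tabulate _ x) (dec-true (Left? x) p))

  out-V₁ : ∀ {x} → ¬ Left x → x ∉ V₁
  out-V₁ {x} ¬p x∈V₁
    with () ← trans (sym (dec-false (Left? x) ¬p))
                    (trans (sym (lookup∘tabulate _ x)) ([]=⇒lookup x∈V₁))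

  split : IsBipartition G V₁
  split (inj₁ (p , q)) = inj₁ (in-V₁ p , out-V₁ q)
  split (inj₂ (p , q)) = inj₂ (out-V₁ p , in-V₁ q)

module Weights (R : CompleteOrderedField) where

  open CompleteOrderedField R
  private
    open module ≤ = IsTotalOrder isTotalOrder using (module Eq)
    open CommutativeRing commutativeRing using (+-identityˡ)

  ℝ : Set
  ℝ = Carrier

  ∑ : ∀ {A : Set} → List A → (A → ℝ) → ℝ
  ∑ xs f = foldr _+_ 0# (List.map f xs)

  syntax ∑ xs (λ x → e) = ∑[ x ∈ xs ] e

  ∑-nonNeg : ∀ {A : Set} {f : A → ℝ} {xs} → All (λ x → 0# ≤ f x) xs → 0# ≤ ∑ xs f
  ∑-nonNeg         []       = ≤.refl
  ∑-nonNeg {f = f} (p ∷ ps) =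
    ≤.trans (∑-nonNeg ps)
      (≤.trans (≤.reflexive (Eq.sym (+-identityˡ _))) (+-monoˡ-≤ _ p))

  record Weight (n : ℕ) : Set where
    field
      nonEmpty : 0 ℕ.< n
      val      : Subset n → ℝ
      nonNeg   : ∀ A → 0# ≤ val A

  open Weight

  size : ∀ {n} → Weight n → ℝ
  size {n} f = ∑[ A ∈ subsets n ] (∣ A ∣ · val f A)

  k : ∀ s (t : ℝ) → 0 ℕ.< s → 0# < t → Weight s
  k s t 0<s 0<t = record
    { nonEmpty = 0<s
    ; val      = λ A → if does (A ≟ ⊤) then t else 0#
    ; nonNeg   = λ A → nn (does (A ≟ ⊤))
    }
    where
    nn : ∀ b → 0# ≤ (if b then t else 0#)
    nn true  = proj₁ 0<t
    nn false = ≤.refl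

  -- g with d new vertices, zero on every set containing a new vertex.

  enlarge : ∀ {n} → Weight n → ∀ d → Weight (n ℕ.+ d)
  enlarge {n} g d = record
    { nonEmpty = ℕ.<-≤-trans (nonEmpty g) (ℕ.m≤m+n n d)
    ; val      = λ B → if does (nonempty? (Vec.drop n B)) then 0# else val g (Vec.take n B)
    ; nonNeg   = λ B → nn (does (nonempty? (Vec.drop n B))) (nonNeg g (Vec.take n B))
    }
    where
    nn : ∀ b {x} → 0# ≤ x → 0# ≤ (if b then 0# else x)
    nn true  _ = ≤.refl
    nn false p = p

  record Embedding {m n} (f : Weight m) (g : Weight n) : Set where
    field
      h           : Fin m → Fin n
      h-injective : Injective _≡_ _≡_ h
      w           : Subset m → Subset n → ℝ
      w-nonNeg    : ∀ A B → 0# ≤ w A B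
      w-support   : ∀ A B → ¬ (h [ A ]⊆ B) → w A B ≈ 0#
      w-covers    : ∀ A → val f A ≤ ∑[ B ∈ filter (λ B → h [ A ]⊆? B) (subsets n) ] w A B
      w-bounded   : ∀ B → ∑[ A ∈ filter (λ A → h [ A ]⊆? B) (subsets m) ] w A B ≤ val g B

  -- The truncated subtraction m ∸ n adds vertices only when m > n.

  _⊂ʷ_ : ∀ {m n} → Weight m → Weight n → Set
  _⊂ʷ_ {m} {n} f g = Embedding f (enlarge g (m ∸ n))

  _⊂ᵍ_ : ∀ {n} → BipartiteGraph → Weight n → Set
  _⊂ᵍ_ {n} F g =
    Σ (Subset order) λ V₁ → IsBipartition graph V₁ ×
    Σ (∃ (_∈ V₁) → Fin n) λ h → Injective _≡_ _≡_ h ×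
    (∀ A y (A⊆V₁ : A ⊆ V₁) → y ∉ V₁ → (∀ x → x ∈ A → Adj y x) →
      ∃[ B ] (∀ x (x∈A : x ∈ A) → h (x , A⊆V₁ x∈A) ∈ B) × 0# < val g B)
    where open BipartiteGraph F

  -- Only the values of c on pairwise disjoint tuples are ever used.

  record Colouring {n} (r : ℕ) (g : Weight n) : Set where
    field
      c        : Vec (Subset n) r → ℝ
      c-nonNeg : ∀ As → PairwiseDisjoint As → 0# ≤ c As
      c-covers : ∀ A → val g A <
        (∑[ As ∈ filter (λ As → ⋃ (toList As) ≟ A) (disjointTuples n r) ] c As)

    colour : Fin r → Weight n
    colour i = record
      { nonEmpty = nonEmpty g
      ; val      = λ A → ∑[ As ∈ filter (λ As → lookup As i ≟ A) (disjointTuples n r) ] c As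
      ; nonNeg   = λ A → ∑-nonNeg (All.filter⁺ (λ As → lookup As i ≟ A)
                     (All.map (c-nonNeg _) (All.all-filter _ (vectors (subsets n) r))))
      }

  data Target : Set₁ where
    weight    : ∀ {n} → Weight n → Target
    bipartite : BipartiteGraph → Target

  _⊂_ : ∀ {n} → Target → Weight n → Set
  weight f    ⊂ g = f ⊂ʷ g
  bipartite F ⊂ g = F ⊂ᵍ g

  _⟶_ : ∀ {n r} → Weight n → (Fin r → Target) → Set
  _⟶_ {r = r} g F = (c : Colouring r g) → ∃[ i ] F i ⊂ Colouring.colour c i

  -- r̂ F ≐ x says that r̂(F) exists as a real number and equals x.

  r̂_≐_ : ∀ {r} → (Fin r → Target) → ℝ → Set
  r̂ F ≐ x = IsInfimum (λ y → ∃[ n ] Σ (Weight n) λ g → (g ⟶ F) × y ≈ size g) x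

  -- (k_{s₁,t₁}, …, k_{s_q,t_q}, K_{s_{q+1},t_{q+1}}, …, K_{s_{q+p},t_{q+p}})

  family : ∀ q p (s : Fin (q ℕ.+ p) → ℕ) (t : Fin q → ℝ) (u : Fin p → ℕ) →
           (∀ i → 0 ℕ.< s i) → (∀ i → 0# < t i) → Fin (q ℕ.+ p) → Target
  family q p s t u 0<s 0<t =
    (λ i → weight (k (s (i ↑ˡ p)) (t i) (0<s (i ↑ˡ p)) (0<t i))) F.++
    (λ j → bipartite (K (s (q ↑ʳ j)) (u j)))

{-# OPTIONS --safe #-}
module Submission where

-- For an injection h into V(g) let mass(h) be the total weight of the sets containing the range
-- of h. Then k_{s,t} ⊂ g means that mass(h) ≥ t for some h on [s], and K_{s,u} ⊂ g (s ≤ u) means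
-- that mass(h) > 0 for some h on [s].
--
-- For a fixed order a, the set of x with k_{a,x} → F is closed because colourings cover strictly,
-- and it lies above t₁ because everything may receive the first colour. Hence a·x attains its
-- minimum M over all k_{a,x} → F, as only finitely many a compete. If e(g) < M′ < M, then each
-- k_{a,M′/a} has a colouring avoiding F. Placing a copy of it on every set A of size a, scaled
-- by g_A·a/M′, colours g, and the mass of h in colour i is at most
-- Σ_A (g_A·|A|/M′)·t_i = (e(g)/M′)·t_i < t_i, so g does not arrow F.

open import Defs
open import Axiom.ExcludedMiddle using (ExcludedMiddle)
open import Algebra.Bundles using (CommutativeRing)
import Algebra.Properties.CommutativeSemigroup as CommutativeSemigroup
import Algebra.Properties.Ring
import Algebra.Properties.Semiring.Mult
open import Data.Bool.Base using (true; false; if_then_else_)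
open import Data.Fin.Base as Fin using (Fin; zero; suc; _↑ˡ_; _↑ʳ_)
import Data.Fin.Properties as Fin
open import Data.Fin.Subset
  using (Subset; inside; outside; _∈_; _∉_; _⊆_; _∪_; ⋃; ∣_∣; ⊤; ⊥; Empty)
open import Data.Fin.Subset.Properties
  using ( _∈?_; nonempty?; ⊆-antisym; ∈⊤; ∉⊥; x∈p∩q⁺; x∈p∩q⁻; x∈p∪q⁻; x∈p∪q⁺
        ; ∣⊥∣≡0; ∣⊤∣≡n)
open import Data.List.Base using (List; []; _∷_; length; filter; allFin)
open import Data.List.Membership.Propositional using () renaming (_∈_ to _∈ˡ_)
open import Data.List.Membership.Propositional.Properties
  using (∈-cartesianProductWith⁺; ∈-filter⁺; ∈-filter⁻; ∈-allFin)
open import Data.List.Relation.Unary.All as All using ([]; _∷_)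
open import Data.List.Relation.Unary.AllPairs using ([]; _∷_)
open import Data.List.Relation.Unary.Any using (here; there)
open import Data.List.Relation.Unary.Unique.Propositional using (Unique)
import Data.List.Relation.Unary.Unique.Propositional.Properties as Unique
open import Data.Nat.Base as ℕ using (ℕ; zero; suc; z≤n; s≤s; z<s; _∸_)
import Data.Nat.Properties as ℕ
open import Data.Product.Base using (Σ; ∃; ∃-syntax; ∃₂; _×_; _,_; proj₁; proj₂)
open import Data.Sum.Base using (_⊎_; inj₁; inj₂; [_,_]′)
open import Data.Vec.Base as Vec
  using (Vec; []; _∷_; lookup; tabulate; toList; replicate; here; there)
open import Data.Vec.Properties
  using ( ≡-dec; lookup⇒[]=; []=⇒lookup; lookup∘tabulate; lookup-map; lookup-replicate
        ; ∷-injective)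
open import Data.Vec.Properties.WithK using ([]=-irrelevant)
import Data.Vec.Relation.Unary.All as AllV
open import Data.Vec.Relation.Unary.AllPairs as AllPairs using ([]; _∷_; allPairs?)
import Data.Vec.Relation.Unary.AllPairs.Properties as AllPairs
open import Function.Base using (_∘_; id; const)
open import Function.Definitions using (Injective)
open import Level using (0ℓ)
open import Relation.Binary.Bundles using (Poset)
import Relation.Binary.Construct.NonStrictToStrict as NonStrictToStrict
open import Relation.Binary.Definitions using (DecidableEquality)
open import Relation.Binary.PropositionalEquality as ≡ using (_≡_; refl; cong; subst)
import Relation.Binary.Reasoning.PartialOrder as PosetReasoning
open import Relation.Binary.Structures using (IsTotalOrder)
open import Relation.Nullary using (¬_; Dec; yes; no; does; contradiction)
open import Relation.Nullary.Decidable
  using (¬?; _×-dec_; dec-true; decidable-stable)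
open import Relation.Unary using (Decidable)

-- Averaging yields weak inequalities only, whereas a colouring has to cover strictly. The repair
-- needs a colour with room to spare, and this is the first one: as `q` is at least 1, its target is
-- a weight, so its threshold is positive. A small extra weight on the tuples (A, ∅, ..., ∅) then
-- makes the covering strict and leaves the mass in all other colours unchanged.
--
-- Both kinds of targets survive the averaging because it preserves zero: in a colour with a graph
-- target every injection on [sᵢ] has mass zero in each copy, hence also in the combination. Weight
-- targets instead need a strict drop below the threshold, which comes from e(g) < M′.
--
-- The empty set is exceptional. It adds nothing to e(g), and M′/a has no meaning for a = 0, yet the
-- value of g at ∅ must be covered as well.

-- Enumerations of subsets and of disjoint tuples.

vectors-unique : ∀ {A : Set} {xs : List A} → Unique xs → ∀ n → Unique (vectors xs n)
vectors-unique unique zero    = [] ∷ []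
vectors-unique unique (suc n) =
  Unique.cartesianProductWith⁺ _∷_ ∷-injective unique (vectors-unique unique n)

∈-vectors : ∀ {A : Set} {xs : List A} → (∀ x → x ∈ˡ xs) → ∀ {n} (v : Vec A n) → v ∈ˡ vectors xs n
∈-vectors ∈xs []      = here refl
∈-vectors ∈xs (x ∷ v) = ∈-cartesianProductWith⁺ _∷_ (∈xs x) (∈-vectors ∈xs v)

subsets-unique : ∀ n → Unique (subsets n)
subsets-unique = vectors-unique (((λ ()) ∷ []) ∷ [] ∷ [])

∈-subsets : ∀ {n} (A : Subset n) → A ∈ˡ subsets n
∈-subsets = ∈-vectors λ { false → here refl ; true → there (here refl) }

disjoint? : ∀ {n} (A B : Subset n) → Dec (Disjoint A B)
disjoint? A B = ¬? (nonempty? _)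

disjointTuples-unique : ∀ n r → Unique (disjointTuples n r)
disjointTuples-unique n r =
  Unique.filter⁺ (allPairs? disjoint?) (vectors-unique (subsets-unique n) r)

∈-disjointTuples⁺ : ∀ {n r} {As : Vec (Subset n) r} → PairwiseDisjoint As → As ∈ˡ disjointTuples n r
∈-disjointTuples⁺ = ∈-filter⁺ (allPairs? disjoint?) (∈-vectors ∈-subsets _)

∈-disjointTuples⁻ : ∀ {n r} {As : Vec (Subset n) r} → As ∈ˡ disjointTuples n r → PairwiseDisjoint As
∈-disjointTuples⁻ {n} {r} = proj₂ ∘ ∈-filter⁻ (allPairs? disjoint?) {xs = vectors (subsets n) r}

∈-tabulate⁺ : ∀ {n} {P : Fin n → Set} (P? : Decidable P) {x} → P x → x ∈ tabulate (does ∘ P?)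
∈-tabulate⁺ P? {x} p =
  lookup⇒[]= x _ (≡.trans (lookup∘tabulate _ x) (dec-true (P? x) p))

∈-tabulate⁻ : ∀ {n} {P : Fin n → Set} (P? : Decidable P) {x} → x ∈ tabulate (does ∘ P?) → P x
∈-tabulate⁻ P? {x} x∈ with P? x in eq
... | yes p = p
... | no ¬p with () ← ≡.trans (≡.sym (cong does eq))
                        (≡.trans (≡.sym (lookup∘tabulate _ x)) ([]=⇒lookup x∈))

-- Images of subsets, and a subset as the image of an initial segment.

module _ {m n} (ι : Fin m → Fin n) where

  image? : (B : Subset m) → Decidable (λ x → ∃[ i ] (i ∈ B × ι i ≡ x))
  image? B x = Fin.any? λ i → (i ∈? B) ×-dec (ι i Fin.≟ x)

  image : Subset m → Subset n
  image B = tabulate (does ∘ image? B)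

  ∈-image⁺ : ∀ {i B} → i ∈ B → ι i ∈ image B
  ∈-image⁺ {i} {B} i∈B = ∈-tabulate⁺ (image? B) (i , i∈B , refl)

  ∈-image⁻ : ∀ {x B} → x ∈ image B → ∃[ i ] (i ∈ B × ι i ≡ x)
  ∈-image⁻ {B = B} = ∈-tabulate⁻ (image? B)

  ∈-image-injective : Injective _≡_ _≡_ ι → ∀ {i B} → ι i ∈ image B → i ∈ B
  ∈-image-injective inj ιi∈ with j , j∈B , ιj≡ιi ← ∈-image⁻ ιi∈ = subst (_∈ _) (inj ιj≡ιi) j∈B

  image-disjoint : Injective _≡_ _≡_ ι → ∀ {A B} → Disjoint A B → Disjoint (image A) (image B)
  image-disjoint inj disj (x , x∈) with x∈p∩q⁻ _ _ x∈
  ... | x∈A , x∈B with i , i∈A , refl ← ∈-image⁻ x∈A =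
    disj (i , x∈p∩q⁺ (i∈A , ∈-image-injective inj x∈B))

  images-disjoint : Injective _≡_ _≡_ ι → ∀ {r} {Bs : Vec (Subset m) r} →
                    PairwiseDisjoint Bs → PairwiseDisjoint (Vec.map image Bs)
  images-disjoint inj = AllPairs.map⁺ ∘ AllPairs.map (image-disjoint inj)

-- The increasing enumeration of `A`. It is the embedding along which a colouring on ∣A∣ points is
-- copied onto `A`.
elements : ∀ {n} (A : Subset n) → Fin ∣ A ∣ → Fin n
elements (outside ∷ A) i       = suc (elements A i)
elements (inside  ∷ A) zero    = zero
elements (inside  ∷ A) (suc i) = suc (elements A i)

elements∈ : ∀ {n} (A : Subset n) i → elements A i ∈ A
elements∈ (outside ∷ A) i       = there (elements∈ A i)
elements∈ (inside  ∷ A) zero    = here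
elements∈ (inside  ∷ A) (suc i) = there (elements∈ A i)

elements-injective : ∀ {n} (A : Subset n) → Injective _≡_ _≡_ (elements A)
elements-injective (outside ∷ A) eq = elements-injective A (Fin.suc-injective eq)
elements-injective (inside  ∷ A) {zero}  {zero}  eq = refl
elements-injective (inside  ∷ A) {suc i} {suc j} eq =
  cong suc (elements-injective A (Fin.suc-injective eq))

elements-surjective : ∀ {n} (A : Subset n) {x} → x ∈ A → ∃[ i ] elements A i ≡ x
elements-surjective (outside ∷ A) (there x∈A)
  with i , refl ← elements-surjective A x∈A = i , refl
elements-surjective (inside  ∷ A) here        = zero , refl
elements-surjective (inside  ∷ A) (there x∈A)
  with i , refl ← elements-surjective A x∈A = suc i , refl

injection-into : ∀ {s n} (A : Subset n) → s ℕ.≤ ∣ A ∣ →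
                 ∃[ h ] (Injective _≡_ _≡_ h × h [ ⊤ {s} ]⊆ A)
injection-into A s≤∣A∣ =
    (λ i → elements A (Fin.inject≤ i s≤∣A∣))
  , (λ {i} {j} eq → Fin.inject≤-injective s≤∣A∣ s≤∣A∣ i j (elements-injective A eq))
  , (λ i _ → elements∈ A _)

-- Unions of tuples and a pigeonhole principle.

module _ {n : ℕ} where

  ∈-⋃⁺ : ∀ {r} (As : Vec (Subset n) r) i {x} → x ∈ lookup As i → x ∈ ⋃ (toList As)
  ∈-⋃⁺ (A ∷ As) zero    x∈ = x∈p∪q⁺ (inj₁ x∈)
  ∈-⋃⁺ (A ∷ As) (suc i) x∈ = x∈p∪q⁺ (inj₂ (∈-⋃⁺ As i x∈))

  ∈-⋃⁻ : ∀ {r} (As : Vec (Subset n) r) {x} → x ∈ ⋃ (toList As) → ∃[ i ] x ∈ lookup As i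
  ∈-⋃⁻ []       x∈ = contradiction x∈ ∉⊥
  ∈-⋃⁻ (A ∷ As) x∈ with x∈p∪q⁻ A _ x∈
  ... | inj₁ x∈A = zero , x∈A
  ... | inj₂ x∈⋃ with i , x∈Ai ← ∈-⋃⁻ As x∈⋃ = suc i , x∈Ai

∣∪∣≤ : ∀ {n} (A B : Subset n) → ∣ A ∪ B ∣ ℕ.≤ ∣ A ∣ ℕ.+ ∣ B ∣
∣∪∣≤ []            []            = z≤n
∣∪∣≤ (outside ∷ A) (outside ∷ B) = ∣∪∣≤ A B
∣∪∣≤ (outside ∷ A) (inside  ∷ B) =
  ℕ.≤-trans (s≤s (∣∪∣≤ A B)) (ℕ.≤-reflexive (≡.sym (ℕ.+-suc ∣ A ∣ ∣ B ∣)))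
∣∪∣≤ (inside  ∷ A) (outside ∷ B) = s≤s (∣∪∣≤ A B)
∣∪∣≤ (inside  ∷ A) (inside  ∷ B) =
  s≤s (ℕ.≤-trans (∣∪∣≤ A B) (ℕ.+-monoʳ-≤ ∣ A ∣ (ℕ.n≤1+n ∣ B ∣)))

∑ⁿ : ∀ {r} → (Fin r → ℕ) → ℕ
∑ⁿ f = Vec.sum (tabulate f)

-- If the first class falls short of `s zero`, subadditivity leaves to the union of the other
-- classes more than the rest of the sum.
pigeonhole : ∀ {n r} (s : Fin r → ℕ) (As : Vec (Subset n) r) →
             ∑ⁿ s ℕ.< ∣ ⋃ (toList As) ∣ → ∃[ i ] s i ℕ.≤ ∣ lookup As i ∣
pigeonhole {n} s [] lt with () ← subst (0 ℕ.<_) (∣⊥∣≡0 n) lt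
pigeonhole s (A ∷ As) lt with s zero ℕ.≤? ∣ A ∣
... | yes s≤∣A∣ = zero , s≤∣A∣
... | no  s≰∣A∣ with i , le ← pigeonhole (s ∘ suc) As
                     (ℕ.+-cancelˡ-< (s zero) _ _ (ℕ.<-≤-trans lt
                       (ℕ.≤-trans (∣∪∣≤ A _) (ℕ.+-monoˡ-≤ _ (ℕ.<⇒≤ (ℕ.≰⇒> s≰∣A∣))))))
                = suc i , le

-- Since `elements A` maps onto `A`, copying turns covering tuples into tuples that count towards
-- the value at exactly `A`.
⋃-images : ∀ {n r} (A : Subset n) (Bs : Vec (Subset ∣ A ∣) r) → ⋃ (toList Bs) ≡ ⊤ →
           ⋃ (toList (Vec.map (image (elements A)) Bs)) ≡ A
⋃-images A Bs ⋃Bs≡⊤ = ⊆-antisym ⊆A A⊆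
  where
  As = Vec.map (image (elements A)) Bs

  lookup-As : ∀ i → lookup As i ≡ image (elements A) (lookup Bs i)
  lookup-As i = lookup-map i _ Bs

  ⊆A : ⋃ (toList As) ⊆ A
  ⊆A x∈ with i , x∈Ai ← ∈-⋃⁻ As x∈
        with j , _ , refl ← ∈-image⁻ (elements A) (subst (_ ∈_) (lookup-As i) x∈Ai) = elements∈ A j

  A⊆ : A ⊆ ⋃ (toList As)
  A⊆ x∈A with j , refl ← elements-surjective A x∈A
         with i , j∈Bi ← ∈-⋃⁻ Bs (subst (j ∈_) (≡.sym ⋃Bs≡⊤) ∈⊤) =
    ∈-⋃⁺ As i (subst (_ ∈_) (≡.sym (lookup-As i)) (∈-image⁺ (elements A) j∈Bi))

only : ∀ {n} r → Subset n → Vec (Subset n) (suc r)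
only r A = A ∷ replicate r ⊥

only-disjoint : ∀ {n} r (A : Subset n) → PairwiseDisjoint (only r A)
only-disjoint {n} r A = disjoint-⊥s A r ∷ ⊥s-disjoint r
  where
  disjoint-⊥ : ∀ (B : Subset n) → Disjoint B ⊥
  disjoint-⊥ B (_ , x∈) = ∉⊥ (proj₂ (x∈p∩q⁻ B ⊥ x∈))

  disjoint-⊥s : ∀ B k → AllV.All (Disjoint B) (replicate k ⊥)
  disjoint-⊥s B zero    = AllV.[]
  disjoint-⊥s B (suc k) = disjoint-⊥ B AllV.∷ disjoint-⊥s B k

  ⊥s-disjoint : ∀ k → PairwiseDisjoint (replicate {A = Subset n} k ⊥)
  ⊥s-disjoint zero    = []
  ⊥s-disjoint (suc k) = disjoint-⊥s ⊥ k ∷ ⊥s-disjoint k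

⋃-only : ∀ {n} r (A : Subset n) → ⋃ (toList (only r A)) ≡ A
⋃-only r A = ⊆-antisym to (∈-⋃⁺ (only r A) zero)
  where
  to : ⋃ (toList (only r A)) ⊆ A
  to x∈ with ∈-⋃⁻ (only r A) x∈
  ... | zero  , x∈A = x∈A
  ... | suc i , x∈⊥ = contradiction (subst (_ ∈_) (lookup-replicate i ⊥) x∈⊥) ∉⊥

-- Serves twice: with `_↑ˡ d` for maps that hit a new vertex, and with `elements A` for maps that
-- leave `A`. In both uses the second alternative means that the mass is zero.
factor : ∀ {s m n} (ι : Fin m → Fin n) (h : Fin s → Fin n) → Injective _≡_ _≡_ h →
         (∃[ h′ ] (Injective _≡_ _≡_ h′ × (∀ i → ι (h′ i) ≡ h i))) ⊎
         (∀ {B} → ¬ h [ ⊤ ]⊆ image ι B)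
factor ι h inj with Fin.all? (λ i → Fin.any? (λ j → ι j Fin.≟ h i))
... | yes f = inj₁ (proj₁ ∘ f
                   , (λ {i} {j} eq → inj (≡.trans (≡.sym (proj₂ (f i)))
                       (≡.trans (cong ι eq) (proj₂ (f j)))))
                   , proj₂ ∘ f)
... | no ¬f = inj₂ λ h⊆ → ¬f λ i → let j , _ , eq = ∈-image⁻ ι (h⊆ i ∈⊤) in j , eq

-- K s u is connected, so V₁ is one of its two sides; because of s ≤ u either side has room for [s].

K-sides : ∀ {s u} → 0 ℕ.< s → 0 ℕ.< u → s ℕ.≤ u → ∀ V₁ →
  IsBipartition (BipartiteGraph.graph (K s u)) V₁ →
  Σ (Fin s → ∃ (_∈ V₁)) λ σ → Injective _≡_ _≡_ (proj₁ ∘ σ) ×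
  (∃[ y ] y ∉ V₁ × ∀ x → x ∈ V₁ → BipartiteGraph.Adj (K s u) y x)
K-sides {suc s-1} {suc u-1} _ _ s≤u V₁ bip = go (bip (adj zero zero))
  where
  s = suc s-1
  u = suc u-1
  open BipartiteGraph (K s u)

  left : ∀ (i : Fin s) → Fin.toℕ (i ↑ˡ u) ℕ.< s
  left i = ℕ.≤-<-trans (ℕ.≤-reflexive (Fin.toℕ-↑ˡ i u)) (Fin.toℕ<n i)

  right : ∀ (j : Fin u) → ¬ Fin.toℕ (s ↑ʳ j) ℕ.< s
  right j = ℕ.≤⇒≯ (ℕ.≤-trans (ℕ.m≤m+n s (Fin.toℕ j)) (ℕ.≤-reflexive (≡.sym (Fin.toℕ-↑ʳ s j))))

  adj : ∀ i j → Adj (i ↑ˡ u) (s ↑ʳ j)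
  adj i j = inj₁ (left i , right j)

  side : ∀ x → (∃[ i ] i ↑ˡ u ≡ x) ⊎ (∃[ j ] s ↑ʳ j ≡ x)
  side x with Fin.splitAt s x in eq
  ... | inj₁ i = inj₁ (i , Fin.splitAt⁻¹-↑ˡ eq)
  ... | inj₂ j = inj₂ (j , Fin.splitAt⁻¹-↑ʳ eq)

  go : (zero ∈ V₁ × (s ↑ʳ zero) ∉ V₁) ⊎ (zero ∉ V₁ × (s ↑ʳ zero) ∈ V₁) → _
  go (inj₁ (0∈ , y∉)) =
      (λ i → i ↑ˡ u , left∈ i)
    , (λ {i} {j} → Fin.↑ˡ-injective u i j)
    , s ↑ʳ zero , y∉ , dominated
    where
    left∈ : ∀ i → (i ↑ˡ u) ∈ V₁
    left∈ i with bip (adj i zero)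
    ... | inj₁ (i∈ , _) = i∈
    ... | inj₂ (_ , y∈) = contradiction y∈ y∉

    dominated : ∀ x → x ∈ V₁ → Adj (s ↑ʳ zero) x
    dominated x x∈ with side x
    ... | inj₁ (i , refl) = symm (adj i zero)
    ... | inj₂ (j , refl) with bip (adj zero j)
    ...   | inj₁ (_ , x∉) = contradiction x∈ x∉
    ...   | inj₂ (0∉ , _) = contradiction 0∈ 0∉
  go (inj₂ (0∉ , y∈)) =
      (λ i → s ↑ʳ Fin.inject≤ i s≤u , right∈ _)
    , (λ {i} {j} eq → Fin.inject≤-injective s≤u s≤u i j (Fin.↑ʳ-injective s _ _ eq))
    , zero , 0∉ , dominated
    where
    right∈ : ∀ j → (s ↑ʳ j) ∈ V₁
    right∈ j with bip (adj zero j)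
    ... | inj₁ (0∈ , _) = contradiction 0∈ 0∉
    ... | inj₂ (_ , j∈) = j∈

    dominated : ∀ x → x ∈ V₁ → Adj zero x
    dominated x x∈ with side x
    ... | inj₂ (j , refl) = adj zero j
    ... | inj₁ (i , refl) with bip (adj i zero)
    ...   | inj₁ (_ , y∉) = contradiction y∈ y∉
    ...   | inj₂ (x∉ , _) = contradiction x∈ x∉

-- Subsets of an enlarged vertex set.

↑ˡ∈⁺ : ∀ {n d} (B : Subset (n ℕ.+ d)) {i} → i ∈ Vec.take n B → i ↑ˡ d ∈ B
↑ˡ∈⁺ {suc n} (_ ∷ B) here       = here
↑ˡ∈⁺ {suc n} (_ ∷ B) (there i∈) = there (↑ˡ∈⁺ B i∈)

↑ˡ∈⁻ : ∀ {n d} (B : Subset (n ℕ.+ d)) {i} → i ↑ˡ d ∈ B → i ∈ Vec.take n B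
↑ˡ∈⁻ {suc n} (_ ∷ B) {zero}  here       = here
↑ˡ∈⁻ {suc n} (_ ∷ B) {suc i} (there i∈) = there (↑ˡ∈⁻ B i∈)

↑ʳ∈⁺ : ∀ n {d} (B : Subset (n ℕ.+ d)) {j} → j ∈ Vec.drop n B → n ↑ʳ j ∈ B
↑ʳ∈⁺ zero    B       j∈ = j∈
↑ʳ∈⁺ (suc n) (_ ∷ B) j∈ = there (↑ʳ∈⁺ n B j∈)

↑ʳ∈⁻ : ∀ n {d} (B : Subset (n ℕ.+ d)) {j} → n ↑ʳ j ∈ B → j ∈ Vec.drop n B
↑ʳ∈⁻ zero    B       j∈         = j∈
↑ʳ∈⁻ (suc n) (_ ∷ B) (there j∈) = ↑ʳ∈⁻ n B j∈

module _ {n d : ℕ} {B : Subset (n ℕ.+ d)} where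

  image-↑ˡ-take : Empty (Vec.drop n B) → image (_↑ˡ d) (Vec.take n B) ≡ B
  image-↑ˡ-take empty = ⊆-antisym to from
    where
    to : image (_↑ˡ d) (Vec.take n B) ⊆ B
    to x∈ with i , i∈ , refl ← ∈-image⁻ (_↑ˡ d) x∈ = ↑ˡ∈⁺ B i∈

    from : B ⊆ image (_↑ˡ d) (Vec.take n B)
    from {x} x∈ with Fin.splitAt n x in eq
    ... | inj₁ i with refl ← Fin.splitAt⁻¹-↑ˡ eq = ∈-image⁺ (_↑ˡ d) (↑ˡ∈⁻ B x∈)
    ... | inj₂ j with refl ← Fin.splitAt⁻¹-↑ʳ {n} eq = contradiction (j , ↑ʳ∈⁻ n B x∈) empty

  take-image-↑ˡ : ∀ {C} → image (_↑ˡ d) C ≡ B → Vec.take n B ≡ C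
  take-image-↑ˡ refl = ⊆-antisym
    (∈-image-injective (_↑ˡ d) (Fin.↑ˡ-injective d _ _) ∘ ↑ˡ∈⁺ B)
    (↑ˡ∈⁻ B ∘ ∈-image⁺ (_↑ˡ d))

  ↑ʳ∉image-↑ˡ : ∀ {C j} → n ↑ʳ j ∉ image (_↑ˡ d) C
  ↑ʳ∉image-↑ˡ {C} {j} j∈ with i , _ , eq ← ∈-image⁻ (_↑ˡ d) {B = C} j∈
    with () ← ≡.trans (≡.sym (Fin.splitAt-↑ˡ n i d))
                      (≡.trans (cong (Fin.splitAt n) eq) (Fin.splitAt-↑ʳ n d j))

module Arrowing (em : ExcludedMiddle 0ℓ) (R : CompleteOrderedField) where

  -- Ordered fields

  module OrderedField where
    open CompleteOrderedField R public
    open CommutativeRing commutativeRing public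
      using ( +-cong; +-congˡ; +-congʳ; +-comm; +-assoc; +-identityˡ; +-identityʳ
            ; -‿inverseˡ; -‿inverseʳ; *-congˡ; *-congʳ; *-comm; *-assoc
            ; *-identityˡ; *-identityʳ; distribˡ; distribʳ; zeroˡ; zeroʳ)
    open IsTotalOrder isTotalOrder public
      using (isPartialOrder; module Eq)
      renaming ( refl to ≤-refl; trans to ≤-trans; antisym to ≤-antisym; total to ≤-total
               ; reflexive to ≤-reflexive; ≤-respʳ-≈ to ≤-respʳ; ≤-respˡ-≈ to ≤-respˡ)
    open Algebra.Properties.Semiring.Mult (CommutativeRing.semiring commutativeRing) public
      using (×-comm-*; ×-assoc-*; ×-congʳ)
    open Algebra.Properties.Ring (CommutativeRing.ring commutativeRing) public
      using (-1*x≈-x; -‿involutive)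
    open CommutativeSemigroup (CommutativeRing.*-commutativeSemigroup commutativeRing) public
      using () renaming (x∙yz≈y∙xz to x*yz≈y*xz)
    open CommutativeSemigroup (CommutativeRing.+-commutativeSemigroup commutativeRing) public
      using () renaming (interchange to +-interchange)

    poset : Poset _ _ _
    poset = record { isPartialOrder = isPartialOrder }

    open PosetReasoning poset public

    <⇒≱ : ∀ {x y} → x < y → ¬ y ≤ x
    <⇒≱ = NonStrictToStrict.<⇒≱ _≈_ _≤_ ≤-antisym

    ≰⇒> : ∀ {x y} → ¬ x ≤ y → y < x
    ≰⇒> = NonStrictToStrict.≰⇒> _≈_ _≤_ Eq.sym ≤-reflexive ≤-total

    <-≤-trans : ∀ {x y z} → x < y → y ≤ z → x < z
    <-≤-trans = NonStrictToStrict.<-≤-trans _≈_ _≤_ Eq.sym ≤-trans ≤-antisym ≤-respʳ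

    ≤-<-trans : ∀ {x y z} → x ≤ y → y < z → x < z
    ≤-<-trans = NonStrictToStrict.≤-<-trans _≈_ _≤_ ≤-trans ≤-antisym ≤-respˡ

    -- Totality alone leaves the case x ≤ y in which x ≈ y is known only up to double negation;
    -- excluded middle closes it.
    ≮⇒≥ : ∀ {x y} → ¬ x < y → y ≤ x
    ≮⇒≥ {x} {y} x≮y with em {y ≤ x}
    ... | yes y≤x = y≤x
    ... | no  y≰x = contradiction (≰⇒> y≰x) x≮y

    +-monoʳ-≤ : ∀ z {x y} → x ≤ y → z + x ≤ z + y
    +-monoʳ-≤ z {x} {y} x≤y = begin
      z + x  ≈⟨ +-comm z x ⟩
      x + z  ≤⟨ +-monoˡ-≤ z x≤y ⟩
      y + z  ≈⟨ +-comm y z ⟩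
      z + y  ∎

    +-mono-≤ : ∀ {x y u v} → x ≤ y → u ≤ v → x + u ≤ y + v
    +-mono-≤ x≤y u≤v = ≤-trans (+-monoˡ-≤ _ x≤y) (+-monoʳ-≤ _ u≤v)

    +-nonNeg : ∀ {x y} → 0# ≤ x → 0# ≤ y → 0# ≤ x + y
    +-nonNeg 0≤x 0≤y = ≤-trans (≤-reflexive (Eq.sym (+-identityˡ _))) (+-mono-≤ 0≤x 0≤y)

    x-y+y≈x : ∀ x y → x + - y + y ≈ x
    x-y+y≈x x y = begin-equality
      x + - y + y    ≈⟨ +-assoc x (- y) y ⟩
      x + (- y + y)  ≈⟨ +-congˡ (-‿inverseˡ y) ⟩
      x + 0#         ≈⟨ +-identityʳ x ⟩
      x              ∎

    x+y-y≈x : ∀ x y → x + y + - y ≈ x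
    x+y-y≈x x y = begin-equality
      x + y + - y    ≈⟨ +-assoc x y (- y) ⟩
      x + (y + - y)  ≈⟨ +-congˡ (-‿inverseʳ y) ⟩
      x + 0#         ≈⟨ +-identityʳ x ⟩
      x              ∎

    +-cancelʳ-≤ : ∀ z {x y} → x + z ≤ y + z → x ≤ y
    +-cancelʳ-≤ z {x} {y} x+z≤y+z = begin
      x            ≈⟨ x+y-y≈x x z ⟨
      x + z + - z  ≤⟨ +-monoˡ-≤ (- z) x+z≤y+z ⟩
      y + z + - z  ≈⟨ x+y-y≈x y z ⟩
      y            ∎

    +-monoˡ-< : ∀ z {x y} → x < y → x + z < y + z
    +-monoˡ-< z x<y = ≰⇒> (<⇒≱ x<y ∘ +-cancelʳ-≤ z)

    x<y+x : ∀ {x y} → 0# < y → x < y + x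
    x<y+x {x} {y} 0<y = begin-strict
      x       ≈⟨ +-identityˡ x ⟨
      0# + x  <⟨ +-monoˡ-< x 0<y ⟩
      y + x   ∎

    0<y-x : ∀ {x y} → x < y → 0# < y + - x
    0<y-x {x} {y} x<y = begin-strict
      0#       ≈⟨ -‿inverseʳ x ⟨
      x + - x  <⟨ +-monoˡ-< (- x) x<y ⟩
      y + - x  ∎

    0≤y-x : ∀ {x y} → x ≤ y → 0# ≤ y + - x
    0≤y-x {x} {y} x≤y = begin
      0#       ≈⟨ -‿inverseʳ x ⟨
      x + - x  ≤⟨ +-monoˡ-≤ (- x) x≤y ⟩
      y + - x  ∎

    *-monoˡ-≤ : ∀ {z x y} → 0# ≤ z → x ≤ y → z * x ≤ z * y
    *-monoˡ-≤ {z} {x} {y} 0≤z x≤y = begin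
      z * x                  ≈⟨ +-identityˡ _ ⟨
      0# + z * x             ≤⟨ +-monoˡ-≤ _ (*-nonNeg 0≤z (0≤y-x x≤y)) ⟩
      z * (y + - x) + z * x  ≈⟨ distribˡ z _ x ⟨
      z * (y + - x + x)      ≈⟨ *-congˡ (x-y+y≈x y x) ⟩
      z * y                  ∎

    *-monoʳ-≤ : ∀ {z x y} → 0# ≤ z → x ≤ y → x * z ≤ y * z
    *-monoʳ-≤ {z} {x} {y} 0≤z x≤y = begin
      x * z  ≈⟨ *-comm x z ⟩
      z * x  ≤⟨ *-monoˡ-≤ 0≤z x≤y ⟩
      z * y  ≈⟨ *-comm z y ⟩
      y * z  ∎

    0≤1 : 0# ≤ 1#
    0≤1 with ≤-total 0# 1#
    ... | inj₁ 0≤1 = 0≤1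
    ... | inj₂ 1≤0 = begin
      0#           ≤⟨ *-nonNeg 0≤-1 0≤-1 ⟩
      - 1# * - 1#  ≈⟨ -1*x≈-x (- 1#) ⟩
      - (- 1#)     ≈⟨ -‿involutive 1# ⟩
      1#           ∎
      where
      0≤-1 : 0# ≤ - 1#
      0≤-1 = ≤-trans (0≤y-x 1≤0) (≤-reflexive (+-identityˡ (- 1#)))

    0<1 : 0# < 1#
    0<1 = 0≤1 , 0≉1

    >⇒≉ : ∀ {x} → 0# < x → ¬ x ≈ 0#
    >⇒≉ 0<x x≈0 = proj₂ 0<x (Eq.sym x≈0)

    *≈1⇒pos : ∀ {x y} → 0# < x → x * y ≈ 1# → 0# < y
    *≈1⇒pos {x} {y} 0<x xy≈1 = ≰⇒> λ y≤0 → <⇒≱ 0<1 (begin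
      1#      ≈⟨ xy≈1 ⟨
      x * y   ≤⟨ *-monoˡ-≤ (proj₁ 0<x) y≤0 ⟩
      x * 0#  ≈⟨ zeroʳ x ⟩
      0#      ∎)

    inverse⁺ : ∀ {x} → 0# < x → ∃[ y ] 0# < y × x * y ≈ 1#
    inverse⁺ 0<x with y , xy≈1 ← inverse _ (>⇒≉ 0<x) = y , *≈1⇒pos 0<x xy≈1 , xy≈1

    *-pos : ∀ {x y} → 0# < x → 0# < y → 0# < x * y
    *-pos {x} {y} 0<x 0<y = ≰⇒> λ xy≤0 → let z , 0<z , xz≈1 = inverse⁺ 0<x in
      <⇒≱ 0<y (begin
        y            ≈⟨ *-identityˡ y ⟨
        1# * y       ≈⟨ *-congʳ xz≈1 ⟨
        x * z * y    ≈⟨ *-congʳ (*-comm x z) ⟩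
        z * x * y    ≈⟨ *-assoc z x y ⟩
        z * (x * y)  ≤⟨ *-monoˡ-≤ (proj₁ 0<z) xy≤0 ⟩
        z * 0#       ≈⟨ zeroʳ z ⟩
        0#           ∎)

    ·-nonNeg : ∀ n {x} → 0# ≤ x → 0# ≤ n · x
    ·-nonNeg zero    0≤x = ≤-refl
    ·-nonNeg (suc n) 0≤x = +-nonNeg 0≤x (·-nonNeg n 0≤x)

    ·-pos : ∀ {n x} → 0 ℕ.< n → 0# < x → 0# < n · x
    ·-pos {suc n} {x} _ 0<x = <-≤-trans 0<x (begin
      x          ≈⟨ +-identityʳ x ⟨
      x + 0#     ≤⟨ +-monoʳ-≤ x (·-nonNeg n (proj₁ 0<x)) ⟩
      x + n · x  ∎)

    ·-mono-≤ : ∀ {m n x y} → m ℕ.≤ n → 0# ≤ y → x ≤ y → m · x ≤ n · y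
    ·-mono-≤ {n = n} z≤n 0≤y x≤y = ·-nonNeg n 0≤y
    ·-mono-≤ (s≤s m≤n)   0≤y x≤y = +-mono-≤ x≤y (·-mono-≤ m≤n 0≤y x≤y)

    -- Were the multiples of `e` bounded, their supremum minus `e` would bound them too, because
    -- adding `e` to a multiple gives a multiple again.
    archimedean : ∀ {e} → 0# < e → ∀ x → ∃[ n ] x < n · e
    archimedean {e} 0<e x with em {∃[ n ] x < n · e}
    ... | yes found = found
    ... | no  none  = contradiction s≤s-e (<⇒≱ s-e<s)
      where
      Multiple : Carrier → Set
      Multiple y = ∃[ n ] y ≈ n · e

      sup : ∃ (IsSupremum Multiple)
      sup = complete Multiple (0# , 0 , Eq.refl)
        (x , λ { (n , y≈ne) → ≤-trans (≤-reflexive y≈ne) (≮⇒≥ (λ x<ne → none (n , x<ne))) })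

      s = proj₁ sup

      s-e<s : s + - e < s
      s-e<s = <-≤-trans (x<y+x 0<e) (≤-reflexive (Eq.trans (+-comm e _) (x-y+y≈x s e)))

      s≤s-e : s ≤ s + - e
      s≤s-e = proj₂ (proj₂ sup) λ { {y} (n , y≈ne) → begin
        y              ≈⟨ x+y-y≈x y e ⟨
        y + e + - e    ≈⟨ +-congʳ (Eq.trans (+-comm y e) (+-congˡ y≈ne)) ⟩
        suc n · e + - e ≤⟨ +-monoˡ-≤ (- e) (proj₁ (proj₂ sup) (suc n , Eq.refl)) ⟩
        s + - e        ∎ }

    room : ∀ n {x y} → x < y → ∃[ ε ] 0# < ε × x + n · ε < y
    room n {x} {y} x<y = ε , 0<ε , x+nε<y
      where
      N = suc n · 1#

      0<N : 0# < N
      0<N = ·-pos {suc n} (s≤s z≤n) 0<1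

      N⁻¹ = proj₁ (inverse⁺ 0<N)

      -- Dividing by n + 1 rather than n keeps one ε in reserve, which makes the final inequality
      -- strict and admits n = 0.
      ε = (y + - x) * N⁻¹

      0<ε : 0# < ε
      0<ε = *-pos (0<y-x x<y) (proj₁ (proj₂ (inverse⁺ 0<N)))

      Nε≈y-x : suc n · ε ≈ y + - x
      Nε≈y-x = begin-equality
        suc n · ε              ≈⟨ ×-congʳ (suc n) (*-identityˡ ε) ⟨
        suc n · (1# * ε)       ≈⟨ ×-assoc-* (suc n) 1# ε ⟨
        N * ((y + - x) * N⁻¹)  ≈⟨ x*yz≈y*xz N _ N⁻¹ ⟩
        (y + - x) * (N * N⁻¹)  ≈⟨ *-congˡ (proj₂ (proj₂ (inverse⁺ 0<N))) ⟩
        (y + - x) * 1#         ≈⟨ *-identityʳ _ ⟩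
        y + - x                ∎

      x+nε<y : x + n · ε < y
      x+nε<y = begin-strict
        x + n · ε      ≈⟨ +-comm x _ ⟩
        n · ε + x      <⟨ +-monoˡ-< x (x<y+x 0<ε) ⟩
        suc n · ε + x  ≈⟨ +-congʳ Nε≈y-x ⟩
        y + - x + x    ≈⟨ x-y+y≈x y x ⟩
        y              ∎

    dense : ∀ {x y} → x < y → ∃[ z ] x < z × z < y
    dense {x} x<y with ε , 0<ε , x+ε<y ← room 1 x<y =
      x + 1 · ε , <-≤-trans (x<y+x (·-pos {1} (s≤s z≤n) 0<ε)) (≤-reflexive (+-comm _ x)) , x+ε<y

  open OrderedField
  open Weights R

  -- Sums

  module _ {P : Set} where

    𝟙 : Dec P → ℝ
    𝟙 p? = if does p? then 1# else 0#

    𝟙-yes : (p? : Dec P) → P → 𝟙 p? ≈ 1#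
    𝟙-yes (yes _) p = Eq.refl
    𝟙-yes (no ¬p) p = contradiction p ¬p

    𝟙-no : (p? : Dec P) → ¬ P → 𝟙 p? ≈ 0#
    𝟙-no (yes p) ¬p = contradiction p ¬p
    𝟙-no (no _)  ¬p = Eq.refl

    0≤𝟙 : (p? : Dec P) → 0# ≤ 𝟙 p?
    0≤𝟙 (yes _) = 0≤1
    0≤𝟙 (no _)  = ≤-refl

    𝟙*≤ : (p? : Dec P) {x y : ℝ} → 0# ≤ y → (P → x ≤ y) → 𝟙 p? * x ≤ y
    𝟙*≤ (yes p) 0≤y x≤y = ≤-trans (≤-reflexive (*-identityˡ _)) (x≤y p)
    𝟙*≤ (no _)  0≤y _   = ≤-trans (≤-reflexive (zeroˡ _)) 0≤y

  𝟙-mono : ∀ {P Q : Set} (p? : Dec P) (q? : Dec Q) → (P → Q) → 𝟙 p? ≤ 𝟙 q?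
  𝟙-mono (yes p) q? f = ≤-reflexive (Eq.sym (𝟙-yes q? (f p)))
  𝟙-mono (no _)  q? f = 0≤𝟙 q?

  𝟙-cong : ∀ {P Q : Set} (p? : Dec P) (q? : Dec Q) → (P → Q) → (Q → P) → 𝟙 p? ≈ 𝟙 q?
  𝟙-cong p? q? f g = ≤-antisym (𝟙-mono p? q? f) (𝟙-mono q? p? g)

  module _ {A : Set} where

    ∑-cong : ∀ (xs : List A) {f g} → (∀ {x} → x ∈ˡ xs → f x ≈ g x) → ∑ xs f ≈ ∑ xs g
    ∑-cong []       f≈g = Eq.refl
    ∑-cong (x ∷ xs) f≈g = +-cong (f≈g (here refl)) (∑-cong xs (f≈g ∘ there))

    ∑-mono : ∀ (xs : List A) {f g} → (∀ {x} → x ∈ˡ xs → f x ≤ g x) → ∑ xs f ≤ ∑ xs g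
    ∑-mono []       f≤g = ≤-refl
    ∑-mono (x ∷ xs) f≤g = +-mono-≤ (f≤g (here refl)) (∑-mono xs (f≤g ∘ there))

    ∑-0 : ∀ (xs : List A) {f} → (∀ {x} → x ∈ˡ xs → f x ≈ 0#) → ∑ xs f ≈ 0#
    ∑-0 []       f≈0 = Eq.refl
    ∑-0 (x ∷ xs) f≈0 =
      Eq.trans (+-cong (f≈0 (here refl)) (∑-0 xs (f≈0 ∘ there))) (+-identityˡ 0#)

    0≤∑ : ∀ (xs : List A) {f} → (∀ {x} → x ∈ˡ xs → 0# ≤ f x) → 0# ≤ ∑ xs f
    0≤∑ xs 0≤f = ∑-nonNeg (All.tabulate 0≤f)

    ≤∑ : ∀ {xs : List A} {f x} → (∀ {y} → y ∈ˡ xs → 0# ≤ f y) → x ∈ˡ xs → f x ≤ ∑ xs f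
    ≤∑ {y ∷ xs} {f} 0≤f (here refl) = begin
      f y           ≈⟨ +-identityʳ (f y) ⟨
      f y + 0#      ≤⟨ +-monoʳ-≤ (f y) (0≤∑ xs (0≤f ∘ there)) ⟩
      f y + ∑ xs f  ∎
    ≤∑ {y ∷ xs} {f} {x} 0≤f (there x∈xs) = begin
      f x           ≤⟨ ≤∑ (0≤f ∘ there) x∈xs ⟩
      ∑ xs f        ≈⟨ +-identityˡ _ ⟨
      0# + ∑ xs f   ≤⟨ +-monoˡ-≤ _ (0≤f (here refl)) ⟩
      f y + ∑ xs f  ∎

    ∑-distrib-+ : ∀ (xs : List A) f g → ∑[ x ∈ xs ] (f x + g x) ≈ ∑ xs f + ∑ xs g
    ∑-distrib-+ []       f g = Eq.sym (+-identityˡ 0#)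
    ∑-distrib-+ (x ∷ xs) f g = begin-equality
      f x + g x + ∑[ y ∈ xs ] (f y + g y)  ≈⟨ +-congˡ (∑-distrib-+ xs f g) ⟩
      f x + g x + (∑ xs f + ∑ xs g)        ≈⟨ +-interchange _ _ _ _ ⟩
      f x + ∑ xs f + (g x + ∑ xs g)        ∎

    *-distribˡ-∑ : ∀ (xs : List A) a f → a * ∑ xs f ≈ ∑[ x ∈ xs ] (a * f x)
    *-distribˡ-∑ []       a f = zeroʳ a
    *-distribˡ-∑ (x ∷ xs) a f = Eq.trans (distribˡ a _ _) (+-congˡ (*-distribˡ-∑ xs a f))

    ∑-const : ∀ (xs : List A) a → ∑[ _ ∈ xs ] a ≈ length xs · a
    ∑-const []       a = Eq.refl
    ∑-const (x ∷ xs) a = +-congˡ (∑-const xs a)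

    -- Turns the filtered sums of the definitions into sums with indicator factors over a fixed
    -- list, where the order of summation can be exchanged.
    ∑-filter : ∀ {P : A → Set} (P? : ∀ x → Dec (P x)) xs f →
               ∑ (filter P? xs) f ≈ ∑[ x ∈ xs ] (𝟙 (P? x) * f x)
    ∑-filter P? []       f = Eq.refl
    ∑-filter P? (x ∷ xs) f with does (P? x)
    ... | true  = +-cong (Eq.sym (*-identityˡ _)) (∑-filter P? xs f)
    ... | false = begin-equality
      ∑ (filter P? xs) f                            ≈⟨ ∑-filter P? xs f ⟩
      ∑[ y ∈ xs ] (𝟙 (P? y) * f y)                  ≈⟨ +-identityˡ _ ⟨
      0# + (∑[ y ∈ xs ] (𝟙 (P? y) * f y))           ≈⟨ +-congʳ (zeroˡ (f x)) ⟨
      0# * f x + (∑[ y ∈ xs ] (𝟙 (P? y) * f y))     ∎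

    ∑-single : (_≟_ : DecidableEquality A) → ∀ {xs y} → Unique xs → y ∈ˡ xs →
               ∀ (f : A → ℝ) → ∑[ x ∈ xs ] (𝟙 (y ≟ x) * f x) ≈ f y
    ∑-single _≟_ {x ∷ xs} {y} (x∉xs ∷ _) (here refl) f = begin-equality
      𝟙 (x ≟ x) * f x + ∑[ z ∈ xs ] (𝟙 (x ≟ z) * f z)
        ≈⟨ +-cong (*-congʳ (𝟙-yes (x ≟ x) refl))
                  (∑-0 xs λ {z} z∈xs → Eq.trans
                    (*-congʳ (𝟙-no (x ≟ z) (All.lookup x∉xs z∈xs))) (zeroˡ _)) ⟩
      1# * f x + 0#
        ≈⟨ +-identityʳ _ ⟩
      1# * f x
        ≈⟨ *-identityˡ _ ⟩
      f x ∎
    ∑-single _≟_ {x ∷ xs} {y} (x∉xs ∷ unique) (there y∈xs) f = begin-equality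
      𝟙 (y ≟ x) * f x + ∑[ z ∈ xs ] (𝟙 (y ≟ z) * f z)
        ≈⟨ +-cong (*-congʳ (𝟙-no (y ≟ x) (All.lookup x∉xs y∈xs ∘ ≡.sym)))
                  (∑-single _≟_ unique y∈xs f) ⟩
      0# * f x + f y
        ≈⟨ +-congʳ (zeroˡ _) ⟩
      0# + f y
        ≈⟨ +-identityˡ _ ⟩
      f y ∎

  ∑-comm : ∀ {A B : Set} (xs : List A) (ys : List B) (f : A → B → ℝ) →
           ∑[ x ∈ xs ] (∑[ y ∈ ys ] f x y) ≈ ∑[ y ∈ ys ] (∑[ x ∈ xs ] f x y)
  ∑-comm []       ys f = Eq.sym (∑-0 ys λ _ → Eq.refl)
  ∑-comm (x ∷ xs) ys f = Eq.trans (+-congˡ (∑-comm xs ys f)) (Eq.sym (∑-distrib-+ ys _ _))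

  ∑-linear : ∀ {A B : Set} (xs : List A) (ys : List B) (f : A → ℝ) (a : B → ℝ) (g : B → A → ℝ) →
             ∑[ x ∈ xs ] (f x * (∑[ y ∈ ys ] (a y * g y x))) ≈
             ∑[ y ∈ ys ] (a y * (∑[ x ∈ xs ] (f x * g y x)))
  ∑-linear xs ys f a g = begin-equality
    ∑[ x ∈ xs ] (f x * (∑[ y ∈ ys ] (a y * g y x)))
      ≈⟨ ∑-cong xs (λ {x} _ → *-distribˡ-∑ ys (f x) _) ⟩
    ∑[ x ∈ xs ] (∑[ y ∈ ys ] (f x * (a y * g y x)))
      ≈⟨ ∑-comm xs ys _ ⟩
    ∑[ y ∈ ys ] (∑[ x ∈ xs ] (f x * (a y * g y x)))
      ≈⟨ ∑-cong ys (λ {y} _ → Eq.trans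
           (∑-cong xs λ {x} _ → x*yz≈y*xz (f x) (a y) (g y x))
           (Eq.sym (*-distribˡ-∑ xs (a y) _))) ⟩
    ∑[ y ∈ ys ] (a y * (∑[ x ∈ xs ] (f x * g y x))) ∎

  module Pushforward {A B : Set} (_≟_ : DecidableEquality B) {xs : List A} {ys : List B}
                     (unique : Unique ys) (φ : A → B) (φ∈ : ∀ {x} → x ∈ˡ xs → φ x ∈ˡ ys) where

    push : (A → ℝ) → B → ℝ
    push c y = ∑[ x ∈ xs ] (𝟙 (φ x ≟ y) * c x)

    -- Change of variables for a pushforward: after exchanging the sums, each `x` meets the single
    -- `y` equal to `φ x`. The instances are enlarged weights, colour subweights, tuples (A, ∅, ...,
    -- ∅), and colourings copied onto a set.
    ∑-push : ∀ f c → ∑[ y ∈ ys ] (f y * push c y) ≈ ∑[ x ∈ xs ] (f (φ x) * c x)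
    ∑-push f c = begin-equality
      ∑[ y ∈ ys ] (f y * push c y)
        ≈⟨ ∑-cong ys (λ {y} _ → *-congˡ (∑-cong xs λ {x} _ → *-comm _ (c x))) ⟩
      ∑[ y ∈ ys ] (f y * (∑[ x ∈ xs ] (c x * 𝟙 (φ x ≟ y))))
        ≈⟨ ∑-linear ys xs f c (λ x y → 𝟙 (φ x ≟ y)) ⟩
      ∑[ x ∈ xs ] (c x * (∑[ y ∈ ys ] (f y * 𝟙 (φ x ≟ y))))
        ≈⟨ ∑-cong xs (λ {x} x∈xs → begin-equality
             c x * (∑[ y ∈ ys ] (f y * 𝟙 (φ x ≟ y)))
               ≈⟨ *-comm (c x) _ ⟩
             (∑[ y ∈ ys ] (f y * 𝟙 (φ x ≟ y))) * c x
               ≈⟨ *-congʳ (∑-cong ys λ {y} _ → *-comm (f y) _) ⟩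
             (∑[ y ∈ ys ] (𝟙 (φ x ≟ y) * f y)) * c x
               ≈⟨ *-congʳ (∑-single _≟_ unique (φ∈ x∈xs) f) ⟩
             f (φ x) * c x ∎) ⟩
      ∑[ x ∈ xs ] (f (φ x) * c x) ∎

  -- Containment

  open Weight

  mass : ∀ {s n} → Weight n → (Fin s → Fin n) → ℝ
  mass {n = n} g h = ∑[ B ∈ subsets n ] (𝟙 (h [ ⊤ ]⊆? B) * val g B)

  module _ {m n} (ι : Fin m → Fin n) where
    open Pushforward _≟_ {xs = subsets m} (subsets-unique n) (image ι) (λ _ → ∈-subsets _) public
      using () renaming (push to pushˢ; ∑-push to ∑-pushˢ)

  -- Seen as a pushforward, the enlarged weight has masses that are computed on `g` itself by change
  -- of variables.
  enlarge≈push : ∀ {n} (g : Weight n) d B → val (enlarge g d) B ≈ pushˢ (_↑ˡ d) (val g) B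
  enlarge≈push {n} g d B with nonempty? (Vec.drop n B)
  ... | yes (j , j∈) = Eq.sym (∑-0 (subsets n) λ {C} _ → Eq.trans
        (*-congʳ (𝟙-no (image (_↑ˡ d) C ≟ B)
          λ { refl → ↑ʳ∉image-↑ˡ {B = B} {C} (↑ʳ∈⁺ n B j∈) }))
        (zeroˡ _))
  ... | no empty = begin-equality
        val g (Vec.take n B)
          ≈⟨ ∑-single _≟_ (subsets-unique n) (∈-subsets _) (val g) ⟨
        ∑[ C ∈ subsets n ] (𝟙 (Vec.take n B ≟ C) * val g C)
          ≈⟨ ∑-cong (subsets n) (λ {C} _ → *-congʳ (𝟙-cong (Vec.take n B ≟ C) (image (_↑ˡ d) C ≟ B)
               (λ { refl → image-↑ˡ-take empty }) take-image-↑ˡ)) ⟩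
        pushˢ (_↑ˡ d) (val g) B ∎

  mass-enlarge : ∀ {s n d} (g : Weight n) (h : Fin s → Fin (n ℕ.+ d)) →
                 mass (enlarge g d) h ≈ ∑[ C ∈ subsets n ] (𝟙 (h [ ⊤ ]⊆? image (_↑ˡ d) C) * val g C)
  mass-enlarge {n = n} {d} g h = Eq.trans
    (∑-cong (subsets (n ℕ.+ d)) λ {B} _ → *-congˡ (enlarge≈push g d B))
    (∑-pushˢ (_↑ˡ d) (λ B → 𝟙 (h [ ⊤ ]⊆? B)) (val g))

  module _ {s m n} (ι : Fin m → Fin n) (inj : Injective _≡_ _≡_ ι)
           {h : Fin s → Fin n} {h′ : Fin s → Fin m} (ιh′≡h : ∀ i → ι (h′ i) ≡ h i) where

    ⊆-image⁺ : ∀ {B} → h′ [ ⊤ ]⊆ B → h [ ⊤ ]⊆ image ι B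
    ⊆-image⁺ h′⊆ i i∈ = subst (_∈ _) (ιh′≡h i) (∈-image⁺ ι (h′⊆ i i∈))

    ⊆-image⁻ : ∀ {B} → h [ ⊤ ]⊆ image ι B → h′ [ ⊤ ]⊆ B
    ⊆-image⁻ h⊆ i i∈ = ∈-image-injective ι inj (subst (_∈ _) (≡.sym (ιh′≡h i)) (h⊆ i i∈))

  -- The common form of containment for both kinds of targets:
  -- ℓ = t for k_{s,t}, and ℓ = 0 for K_{s,u} with s ≤ u.

  record Threshold (T : Target) (s : ℕ) (ℓ : ℝ) : Set where
    field
      0≤ℓ : 0# ≤ ℓ
      to  : ∀ {n} {g : Weight n} → T ⊂ g →
            ∃[ h ] Injective _≡_ _≡_ h × ℓ ≤ mass {s} g h × 0# < mass g h
      from : ∀ {n} {g : Weight n} (h : Fin s → Fin n) → Injective _≡_ _≡_ h →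
             ℓ ≤ mass g h → 0# < mass g h → T ⊂ g

  open Threshold public

  module _ {s t} (0<s : 0 ℕ.< s) (0<t : 0# < t) where

    k-⊤ : val (k s t 0<s 0<t) ⊤ ≈ t
    k-⊤ with ⊤ {s} ≟ ⊤
    ... | yes _ = Eq.refl
    ... | no ⊤≢⊤ = contradiction refl ⊤≢⊤

    k-≉⊤ : ∀ {A} → ¬ A ≡ ⊤ → val (k s t 0<s 0<t) A ≈ 0#
    k-≉⊤ {A} A≢⊤ with A ≟ ⊤
    ... | yes A≡⊤ = contradiction A≡⊤ A≢⊤
    ... | no _ = Eq.refl

  -- Only the full set carries value in `k`, so an embedding amounts to distributing `t` over the
  -- supersets of the range of `h`, and their total value is the mass.
  k-threshold : ∀ {s t} (0<s : 0 ℕ.< s) (0<t : 0# < t) → Threshold (weight (k s t 0<s 0<t)) s t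
  k-threshold {s} {t} 0<s 0<t .0≤ℓ = proj₁ 0<t
  k-threshold {s} {t} 0<s 0<t .to {n} {g} e = conclude
    where
    open Embedding e
    d = s ∸ n
    g⁺ = enlarge g d

    w≤g⁺ : ∀ {B} → h [ ⊤ ]⊆ B → w ⊤ B ≤ val g⁺ B
    w≤g⁺ {B} h⊆B = ≤-trans
      (≤∑ {f = λ A → w A B} (λ {A} _ → w-nonNeg A B)
        (∈-filter⁺ (λ A → h [ A ]⊆? B) (∈-subsets ⊤) h⊆B))
      (w-bounded B)

    t≤mass⁺ : t ≤ mass g⁺ h
    t≤mass⁺ = begin
      t
        ≈⟨ k-⊤ 0<s 0<t ⟨
      val (k s t 0<s 0<t) ⊤
        ≤⟨ w-covers ⊤ ⟩
      ∑[ B ∈ filter (λ B → h [ ⊤ ]⊆? B) (subsets (n ℕ.+ d)) ] w ⊤ B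
        ≤⟨ ∑-mono (filter (λ B → h [ ⊤ ]⊆? B) (subsets (n ℕ.+ d)))
             (λ {B} B∈ → w≤g⁺ (proj₂
               (∈-filter⁻ (λ B → h [ ⊤ ]⊆? B) {xs = subsets (n ℕ.+ d)} B∈))) ⟩
      ∑[ B ∈ filter (λ B → h [ ⊤ ]⊆? B) (subsets (n ℕ.+ d)) ] val g⁺ B
        ≈⟨ ∑-filter (λ B → h [ ⊤ ]⊆? B) (subsets (n ℕ.+ d)) (val g⁺) ⟩
      mass g⁺ h ∎

    conclude : ∃[ h′ ] Injective _≡_ _≡_ h′ × t ≤ mass {s} g h′ × 0# < mass g h′
    conclude with factor (_↑ˡ d) h h-injective
    -- A range that meets a new vertex lies in no set of positive value; its mass zero contradicts
    -- `0<t`.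
    ... | inj₂ h⊈ = contradiction (≤-trans t≤mass⁺ (≤-reflexive (Eq.trans (mass-enlarge g h)
          (∑-0 (subsets n) λ {C} _ → Eq.trans
            (*-congʳ (𝟙-no (h [ ⊤ ]⊆? image (_↑ˡ d) C) h⊈)) (zeroˡ _)))))
          (<⇒≱ 0<t)
    ... | inj₁ (h′ , inj , eq) = h′ , inj , t≤mass , <-≤-trans 0<t t≤mass
      where
      t≤mass : t ≤ mass g h′
      t≤mass = ≤-trans t≤mass⁺ (≤-trans (≤-reflexive (mass-enlarge g h))
        (∑-mono (subsets n) λ {C} _ → *-monoʳ-≤ (nonNeg g C)
          (𝟙-mono (h [ ⊤ ]⊆? image (_↑ˡ d) C) (h′ [ ⊤ ]⊆? C)
            (⊆-image⁻ (_↑ˡ d) (Fin.↑ˡ-injective d _ _) eq))))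
  k-threshold {s} {t} 0<s 0<t .from {n} {g} h inj t≤mass _ = record
    { h           = h⁺
    ; h-injective = inj ∘ Fin.↑ˡ-injective d _ _
    ; w           = w
    ; w-nonNeg    = λ A B → *-nonNeg (0≤𝟙 (A ≟ ⊤)) (w⊤-nonNeg B)
    ; w-support   = λ A B h⊈ → support A B h⊈ (A ≟ ⊤)
    ; w-covers    = λ A → covers A (A ≟ ⊤)
    ; w-bounded   = bounded
    }
    where
    d = s ∸ n
    g⁺ = enlarge g d
    h⁺ = λ i → h i ↑ˡ d

    w⊤ : Subset (n ℕ.+ d) → ℝ
    w⊤ B = 𝟙 (h⁺ [ ⊤ ]⊆? B) * val g⁺ B

    -- The full set receives everything available on the supersets of the range. An excess over `t`
    -- is harmless, since covering asks only for at least `t`.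
    w : Subset s → Subset (n ℕ.+ d) → ℝ
    w A B = 𝟙 (A ≟ ⊤) * w⊤ B

    w⊤-nonNeg : ∀ B → 0# ≤ w⊤ B
    w⊤-nonNeg B = *-nonNeg (0≤𝟙 (h⁺ [ ⊤ ]⊆? B)) (nonNeg g⁺ B)

    support : ∀ A B → ¬ h⁺ [ A ]⊆ B → (A≟⊤ : Dec (A ≡ ⊤)) → 𝟙 A≟⊤ * w⊤ B ≈ 0#
    support A B h⊈ (yes refl) = Eq.trans
      (*-congˡ (Eq.trans (*-congʳ (𝟙-no (h⁺ [ ⊤ ]⊆? B) h⊈)) (zeroˡ _))) (zeroʳ _)
    support A B h⊈ (no _)     = zeroˡ _

    covers : ∀ A (A≟⊤ : Dec (A ≡ ⊤)) →
             (if does A≟⊤ then t else 0#) ≤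
             ∑[ B ∈ filter (λ B → h⁺ [ A ]⊆? B) (subsets (n ℕ.+ d)) ] (𝟙 A≟⊤ * w⊤ B)
    covers A (yes refl) = begin
      t
        ≤⟨ t≤mass ⟩
      mass g h
        ≤⟨ ∑-mono (subsets n) (λ {C} _ → *-monoʳ-≤ (nonNeg g C)
            (𝟙-mono (h [ ⊤ ]⊆? C) (h⁺ [ ⊤ ]⊆? image (_↑ˡ d) C)
              (⊆-image⁺ (_↑ˡ d) (Fin.↑ˡ-injective d _ _) (λ _ → refl)))) ⟩
      ∑[ C ∈ subsets n ] (𝟙 (h⁺ [ ⊤ ]⊆? image (_↑ˡ d) C) * val g C)
        ≈⟨ mass-enlarge g h⁺ ⟨
      mass g⁺ h⁺
        ≈⟨ ∑-filter (λ B → h⁺ [ ⊤ ]⊆? B) (subsets (n ℕ.+ d)) (val g⁺) ⟨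
      ∑[ B ∈ filter (λ B → h⁺ [ ⊤ ]⊆? B) (subsets (n ℕ.+ d)) ] (val g⁺ B)
        ≈⟨ ∑-cong (filter (λ B → h⁺ [ ⊤ ]⊆? B) (subsets (n ℕ.+ d))) (λ {B} B∈ → Eq.sym
            (Eq.trans (*-identityˡ _)
            (Eq.trans (*-congʳ (𝟙-yes (h⁺ [ ⊤ ]⊆? B)
              (proj₂ (∈-filter⁻ (λ B → h⁺ [ ⊤ ]⊆? B) {xs = subsets (n ℕ.+ d)} B∈)))) (*-identityˡ _)))) ⟩
      ∑[ B ∈ filter (λ B → h⁺ [ ⊤ ]⊆? B) (subsets (n ℕ.+ d)) ] (1# * w⊤ B) ∎
    covers A (no _) = 0≤∑ (filter (λ B → h⁺ [ A ]⊆? B) (subsets (n ℕ.+ d)))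
      λ {B} _ → *-nonNeg ≤-refl (w⊤-nonNeg B)

    bounded : ∀ B → ∑[ A ∈ filter (λ A → h⁺ [ A ]⊆? B) (subsets s) ] w A B ≤ val g⁺ B
    bounded B = begin
      ∑[ A ∈ filter (λ A → h⁺ [ A ]⊆? B) (subsets s) ] w A B
        ≈⟨ ∑-filter (λ A → h⁺ [ A ]⊆? B) (subsets s) (λ A → w A B) ⟩
      ∑[ A ∈ subsets s ] (𝟙 (h⁺ [ A ]⊆? B) * w A B)
        ≤⟨ ∑-mono (subsets s) (λ {A} _ → 𝟙*≤ (h⁺ [ A ]⊆? B)
             (*-nonNeg (0≤𝟙 (⊤ ≟ A)) (w⊤-nonNeg B))
             λ _ → *-monoʳ-≤ (w⊤-nonNeg B) (𝟙-mono (A ≟ ⊤) (⊤ ≟ A) ≡.sym)) ⟩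
      ∑[ A ∈ subsets s ] (𝟙 (⊤ ≟ A) * w⊤ B)
        ≈⟨ ∑-single _≟_ (subsets-unique s) (∈-subsets ⊤) (λ _ → w⊤ B) ⟩
      w⊤ B
        ≤⟨ 𝟙*≤ (h⁺ [ ⊤ ]⊆? B) (nonNeg g⁺ B) (λ _ → ≤-refl) ⟩
      val g⁺ B ∎

  mass-pos⁻ : ∀ {s n} (g : Weight n) (h : Fin s → Fin n) → 0# < mass g h →
              ∃[ B ] h [ ⊤ ]⊆ B × 0# < val g B
  mass-pos⁻ {n = n} g h 0<mass with em {∃[ B ] h [ ⊤ ]⊆ B × 0# < val g B}
  ... | yes found = found
  ... | no  none  = contradiction
    (≤-reflexive (∑-0 (subsets n) λ {B} _ → ≤-antisym
      (𝟙*≤ (h [ ⊤ ]⊆? B) ≤-refl λ h⊆B → ≮⇒≥ λ 0<gB → none (B , h⊆B , 0<gB))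
      (*-nonNeg (0≤𝟙 (h [ ⊤ ]⊆? B)) (nonNeg g B))))
    (<⇒≱ 0<mass)

  val≤mass : ∀ {s n} (g : Weight n) (h : Fin s → Fin n) {B} → h [ ⊤ ]⊆ B → val g B ≤ mass g h
  val≤mass {n = n} g h {B} h⊆B = ≤-trans
    (≤-reflexive (Eq.sym (Eq.trans (*-congʳ (𝟙-yes (h [ ⊤ ]⊆? B) h⊆B)) (*-identityˡ _))))
    (≤∑ {f = λ B → 𝟙 (h [ ⊤ ]⊆? B) * val g B}
      (λ {C} _ → *-nonNeg (0≤𝟙 (h [ ⊤ ]⊆? C)) (nonNeg g C)) (∈-subsets B))

  -- Some vertex outside `V₁` is adjacent to all of `V₁`, so the condition for A = `V₁` demands a
  -- single set of positive value containing the whole range, which is positivity of the mass.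
  -- Conversely such a set serves every A at once, with the side of `s` vertices as `V₁`.
  K-threshold : ∀ {s u} → 0 ℕ.< s → 0 ℕ.< u → s ℕ.≤ u → Threshold (bipartite (K s u)) s 0#
  K-threshold 0<s 0<u s≤u .0≤ℓ = ≤-refl
  K-threshold {s} {u} 0<s 0<u s≤u .to {n} {g} (V₁ , bip , h , h-inj , dominated)
    with σ , σ-inj , y , y∉ , adj ← K-sides 0<s 0<u s≤u V₁ bip
    with B , h⊆B , 0<gB ← dominated V₁ y id y∉ adj =
      h ∘ σ , σ-inj ∘ cong proj₁ ∘ h-inj , proj₁ 0<mass , 0<mass
    where
    0<mass : 0# < mass g (h ∘ σ)
    0<mass = <-≤-trans 0<gB (val≤mass g (h ∘ σ) λ i _ → h⊆B (proj₁ (σ i)) (proj₂ (σ i)))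
  K-threshold {s} {u} 0<s 0<u s≤u .from {n} {g} h inj _ 0<mass
    with B , h⊆B , 0<gB ← mass-pos⁻ g h 0<mass =
      V₁ , proj₂ (BipartiteGraph.bipartite (K s u)) , (λ x → h (Fin.fromℕ< (left x)))
    , h∘left-injective , (λ A y _ _ _ → B , (λ x x∈ → h⊆B _ ∈⊤) , 0<gB)
    where
    V₁ : Subset (s ℕ.+ u)
    V₁ = proj₁ (BipartiteGraph.bipartite (K s u))

    left : (x : ∃ (_∈ V₁)) → Fin.toℕ (proj₁ x) ℕ.< s
    left (x , x∈) = ∈-tabulate⁻ (λ x → Fin.toℕ x ℕ.<? s) x∈

    h∘left-injective : Injective _≡_ _≡_ (λ x → h (Fin.fromℕ< (left x)))
    -- The domain consists of vertices paired with membership proofs, so uniqueness of these proofs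
    -- is required as well.
    h∘left-injective {x , x∈} {y , y∈} eq
      with refl ← Fin.toℕ-injective (Fin.fromℕ<-injective _ _ (left (x , x∈)) (left (y , y∈)) (inj eq)) =
        cong (x ,_) ([]=-irrelevant x∈ y∈)

  ∑-k : ∀ {s t} (0<s : 0 ℕ.< s) (0<t : 0# < t) (f : Subset s → ℝ) →
        ∑[ A ∈ subsets s ] (f A * val (k s t 0<s 0<t) A) ≈ f ⊤ * t
  ∑-k {s} {t} 0<s 0<t f = begin-equality
    ∑[ A ∈ subsets s ] (f A * val (k s t 0<s 0<t) A)
      ≈⟨ ∑-cong (subsets s) (λ {A} _ → concentrated A (⊤ ≟ A)) ⟩
    ∑[ A ∈ subsets s ] (𝟙 (⊤ ≟ A) * (f A * val (k s t 0<s 0<t) A))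
      ≈⟨ ∑-single _≟_ (subsets-unique s) (∈-subsets ⊤) (λ A → f A * val (k s t 0<s 0<t) A) ⟩
    f ⊤ * val (k s t 0<s 0<t) ⊤
      ≈⟨ *-congˡ (k-⊤ 0<s 0<t) ⟩
    f ⊤ * t ∎
    where
    concentrated : ∀ A (⊤≟A : Dec (⊤ ≡ A)) →
                   f A * val (k s t 0<s 0<t) A ≈ 𝟙 ⊤≟A * (f A * val (k s t 0<s 0<t) A)
    concentrated A (yes _)   = Eq.sym (*-identityˡ _)
    concentrated A (no ⊤≢A) = Eq.trans
      (Eq.trans (*-congˡ (k-≉⊤ 0<s 0<t (⊤≢A ∘ ≡.sym))) (zeroʳ _)) (Eq.sym (zeroˡ _))

  size≈ : ∀ {n} (g : Weight n) → size g ≈ ∑[ A ∈ subsets n ] ((∣ A ∣ · 1#) * val g A)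
  size≈ {n} g = ∑-cong (subsets n) λ {A} _ →
    Eq.sym (Eq.trans (×-assoc-* ∣ A ∣ 1# (val g A)) (×-congʳ ∣ A ∣ (*-identityˡ (val g A))))

  size-k : ∀ {s t} (0<s : 0 ℕ.< s) (0<t : 0# < t) → size (k s t 0<s 0<t) ≈ s · t
  size-k {s} {t} 0<s 0<t = begin-equality
    size (k s t 0<s 0<t)                                                ≈⟨ size≈ (k s t 0<s 0<t) ⟩
    ∑[ A ∈ subsets s ] ((∣ A ∣ · 1#) * val (k s t 0<s 0<t) A)          ≈⟨ ∑-k 0<s 0<t (λ A → ∣ A ∣ · 1#) ⟩
    (∣ ⊤ {s} ∣ · 1#) * t                                                ≡⟨ cong (λ m → (m · 1#) * t) (∣⊤∣≡n s) ⟩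
    (s · 1#) * t                                                        ≈⟨ ×-assoc-* s 1# t ⟩
    s · (1# * t)                                                        ≈⟨ ×-congʳ s (*-identityˡ t) ⟩
    s · t                                                               ∎

  size-nonNeg : ∀ {n} (g : Weight n) → 0# ≤ size g
  size-nonNeg {n} g = 0≤∑ (subsets n) λ {A} _ → ·-nonNeg ∣ A ∣ (nonNeg g A)

  -- Colourings

  module _ {n r : ℕ} where

    -- Covering sums and masses of colour subweights are both linear functionals of the colouring;
    -- this common form lets scaling, addition and copying be treated once for both.
    tupleSum : (Vec (Subset n) r → ℝ) → (Vec (Subset n) r → ℝ) → ℝ
    tupleSum f c = ∑[ As ∈ disjointTuples n r ] (f As * c As)

    tupleTotal : Subset n → (Vec (Subset n) r → ℝ) → ℝ
    tupleTotal A = tupleSum λ As → 𝟙 (⋃ (toList As) ≟ A)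

    tupleMass : ∀ {s} → Fin r → (Fin s → Fin n) → (Vec (Subset n) r → ℝ) → ℝ
    tupleMass i h = tupleSum λ As → 𝟙 (h [ ⊤ ]⊆? lookup As i)

    tupleSum-mono : ∀ {f f′} {c} → (∀ As → PairwiseDisjoint As → 0# ≤ c As) →
                    (∀ As → f As ≤ f′ As) → tupleSum f c ≤ tupleSum f′ c
    tupleSum-mono 0≤c f≤f′ = ∑-mono (disjointTuples n r) λ {As} As∈ →
      *-monoʳ-≤ (0≤c As (∈-disjointTuples⁻ As∈)) (f≤f′ As)

    mass-colour : ∀ {s} {g : Weight n} (C : Colouring r g) i (h : Fin s → Fin n) →
                  mass (Colouring.colour C i) h ≈ tupleMass i h (Colouring.c C)
    mass-colour C i h = begin-equality
      mass (colour i) h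
        ≈⟨ ∑-cong (subsets n) (λ {A} _ →
             *-congˡ (∑-filter (λ As → lookup As i ≟ A) (disjointTuples n r) c)) ⟩
      ∑[ A ∈ subsets n ] (𝟙 (h [ ⊤ ]⊆? A) * push c A)
        ≈⟨ ∑-push (λ A → 𝟙 (h [ ⊤ ]⊆? A)) c ⟩
      tupleMass i h c ∎
      where
      open Colouring C
      open Pushforward _≟_ {xs = disjointTuples n r} (subsets-unique n)
        (λ As → lookup As i) (λ _ → ∈-subsets _)

    total-filter : ∀ A (c : Vec (Subset n) r → ℝ) →
                   ∑[ As ∈ filter (λ As → ⋃ (toList As) ≟ A) (disjointTuples n r) ] c As ≈ tupleTotal A c
    total-filter A c = ∑-filter (λ As → ⋃ (toList As) ≟ A) (disjointTuples n r) c

  module _ {s t r} (0<s : 0 ℕ.< s) (0<t : 0# < t) (C : Colouring r (k s t 0<s 0<t)) where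
    open Colouring C

    k-total : t < tupleTotal ⊤ c
    k-total = <-≤-trans (≤-<-trans (≤-reflexive (Eq.sym (k-⊤ 0<s 0<t))) (c-covers ⊤))
                        (≤-reflexive (total-filter ⊤ c))

  module _ {s t x r} (0<s : 0 ℕ.< s) (0<t : 0# < t) (0<x : 0# < x)
           (C : Colouring r (k s t 0<s 0<t)) where
    open Colouring C

    -- Among the covering conditions only the one at `⊤` depends on the value of `k`; at all other
    -- sets both weights vanish and the old condition carries over.
    k-recolour : x < tupleTotal ⊤ c → Colouring r (k s x 0<s 0<x)
    k-recolour x<total = record { c = c ; c-nonNeg = c-nonNeg ; c-covers = covers }
      where
      covers : ∀ A → val (k s x 0<s 0<x) A <
               ∑[ As ∈ filter (λ As → ⋃ (toList As) ≟ A) (disjointTuples s r) ] c As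
      covers A with A ≟ ⊤ | c-covers A
      ... | yes refl | _  = <-≤-trans x<total (≤-reflexive (Eq.sym (total-filter ⊤ c)))
      ... | no  _    | lt = lt

  -- Colourings that use only the first colour.

  module OnlyFirst {n r : ℕ} where
    open Pushforward (≡-dec _≟_) {xs = subsets n} (disjointTuples-unique n (suc r)) (only r)
      (λ _ → ∈-disjointTuples⁺ (only-disjoint r _)) public

    push-nonNeg : ∀ {c} → (∀ A → 0# ≤ c A) → ∀ As → 0# ≤ push c As
    push-nonNeg 0≤c As = 0≤∑ (subsets n) λ {A} _ →
      *-nonNeg (0≤𝟙 (≡-dec _≟_ (only r A) As)) (0≤c A)

    total-push : ∀ A c → tupleTotal A (push c) ≈ c A
    total-push A c = begin-equality
      tupleTotal A (push c)
        ≈⟨ ∑-push (λ As → 𝟙 (⋃ (toList As) ≟ A)) c ⟩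
      ∑[ B ∈ subsets n ] (𝟙 (⋃ (toList (only r B)) ≟ A) * c B)
        ≈⟨ ∑-cong (subsets n) (λ {B} _ → *-congʳ (𝟙-cong (⋃ (toList (only r B)) ≟ A) (A ≟ B)
             (λ eq → ≡.trans (≡.sym eq) (⋃-only r B)) (λ { refl → ⋃-only r A }))) ⟩
      ∑[ B ∈ subsets n ] (𝟙 (A ≟ B) * c B)
        ≈⟨ ∑-single _≟_ (subsets-unique n) (∈-subsets A) c ⟩
      c A ∎

    mass-push-zero : ∀ {s} (h : Fin s → Fin n) {c} → (∀ A → 0# ≤ c A) →
                     tupleMass zero h (push c) ≤ ∑ (subsets n) c
    mass-push-zero h {c} 0≤c = ≤-trans
      (≤-reflexive (∑-push (λ As → 𝟙 (h [ ⊤ ]⊆? lookup As zero)) c))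
      (∑-mono (subsets n) λ {B} _ → 𝟙*≤ (h [ ⊤ ]⊆? B) (0≤c B) λ _ → ≤-refl)

    -- All classes but the first are empty and cannot contain a nonempty range. An empty range, by
    -- contrast, would collect mass from them.
    mass-push-suc : ∀ {s} → 0 ℕ.< s → ∀ i (h : Fin s → Fin n) c → tupleMass (suc i) h (push c) ≈ 0#
    mass-push-suc (s≤s _) i h c = Eq.trans (∑-push (λ As → 𝟙 (h [ ⊤ ]⊆? lookup As (suc i))) c)
      (∑-0 (subsets n) λ {B} _ → Eq.trans (*-congʳ
        (𝟙-no (h [ ⊤ ]⊆? lookup (only r B) (suc i))
          λ h⊆ → ∉⊥ (subst (h zero ∈_) (lookup-replicate i ⊥) (h⊆ zero ∈⊤)))) (zeroˡ _))

  -- The minimum over the arrowing weights `k`.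

  module Family {r} (F : Fin (suc r) → Target) (s : Fin (suc r) → ℕ) (ℓ : Fin (suc r) → ℝ)
                (0<s : ∀ i → 0 ℕ.< s i) (0<ℓ₀ : 0# < ℓ zero)
                (threshold : ∀ i → Threshold (F i) (s i) (ℓ i)) where

    -- The weak inequality suits both kinds of targets: with `ℓ i` zero it says that the mass
    -- vanishes, and for a weight the strictness is recovered later by scaling.
    avoiding-mass : ∀ {n} {g : Weight n} (C : Colouring (suc r) g) →
                    ¬ (∃[ i ] F i ⊂ Colouring.colour C i) →
                    ∀ i (h : Fin (s i) → Fin n) → Injective _≡_ _≡_ h →
                    tupleMass i h (Colouring.c C) ≤ ℓ i
    avoiding-mass C avoids i h inj = ≤-trans (≤-reflexive (Eq.sym (mass-colour C i h))) mass≤ℓ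
      where
      mass≤ℓ : mass (Colouring.colour C i) h ≤ ℓ i
      mass≤ℓ with ≤-total (ℓ i) (mass (Colouring.colour C i) h)
      ... | inj₂ mass≤ℓ = mass≤ℓ
      ... | inj₁ ℓ≤mass = ≤-trans
        (≮⇒≥ λ 0<mass → avoids (i , from (threshold i) h inj ℓ≤mass 0<mass)) (0≤ℓ (threshold i))

    -- The covering condition only has to be checked in its weak form: the slack
    -- in the first colour allows a small weight to be added to every (A, ∅, …, ∅).

    no-arrow : ∀ {n} {g : Weight n} (c : Vec (Subset n) (suc r) → ℝ) (b : Fin (suc r) → ℝ) →
               (∀ As → PairwiseDisjoint As → 0# ≤ c As) →
               (∀ A → val g A ≤ tupleTotal A c) →
               (∀ i (h : Fin (s i) → Fin n) → Injective _≡_ _≡_ h → tupleMass i h c ≤ b i) →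
               b zero < ℓ zero → (∀ i → b (suc i) < ℓ (suc i) ⊎ b (suc i) ≤ 0#) →
               ¬ (g ⟶ F)
    no-arrow {n} {g} c b 0≤c covers mass≤b b₀<ℓ₀ b<ℓ g⟶F
      = impossible (g⟶F C)
      where
      -- One `ε` is added for every subset, so the mass in the first colour grows by at most
      -- `length (subsets n)` times `ε`.
      slack = room (length (subsets n)) b₀<ℓ₀

      ε : ℝ
      ε = proj₁ slack

      0<ε : 0# < ε
      0<ε = proj₁ (proj₂ slack)

      b₀+Nε<ℓ₀ : b zero + length (subsets n) · ε < ℓ zero
      b₀+Nε<ℓ₀ = proj₂ (proj₂ slack)

      open OnlyFirst {n} {r}

      c′ : Vec (Subset n) (suc r) → ℝ
      c′ As = c As + push (λ _ → ε) As

      split : ∀ f → tupleSum f c′ ≈ tupleSum f c + tupleSum f (push λ _ → ε)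
      split f = Eq.trans (∑-cong (disjointTuples n (suc r)) λ {As} _ → distribˡ (f As) (c As) _)
                         (∑-distrib-+ (disjointTuples n (suc r)) (λ As → f As * c As)
                           (λ As → f As * push (λ _ → ε) As))

      C : Colouring (suc r) g
      C = record
        { c        = c′
        ; c-nonNeg = λ As disj → +-nonNeg (0≤c As disj) (push-nonNeg (λ _ → proj₁ 0<ε) As)
        ; c-covers = λ A → begin-strict
            val g A                                          <⟨ x<y+x 0<ε ⟩
            ε + val g A                                      ≈⟨ +-comm ε _ ⟩
            val g A + ε                                      ≤⟨ +-monoˡ-≤ ε (covers A) ⟩
            tupleTotal A c + ε                               ≈⟨ +-congˡ (total-push A (λ _ → ε)) ⟨
            tupleTotal A c + tupleTotal A (push λ _ → ε)     ≈⟨ split _ ⟨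
            tupleTotal A c′                                  ≈⟨ total-filter A c′ ⟨
            ∑[ As ∈ filter (λ As → ⋃ (toList As) ≟ A) (disjointTuples n (suc r)) ] c′ As  ∎
        }

      mass₀<ℓ₀ : ∀ h → Injective _≡_ _≡_ h → tupleMass zero h c′ < ℓ zero
      mass₀<ℓ₀ h inj = begin-strict
        tupleMass zero h c′
          ≈⟨ split _ ⟩
        tupleMass zero h c + tupleMass zero h (push λ _ → ε)
          ≤⟨ +-mono-≤ (mass≤b zero h inj) (mass-push-zero h λ _ → proj₁ 0<ε) ⟩
        b zero + (∑[ _ ∈ subsets n ] ε)
          ≈⟨ +-congˡ (∑-const (subsets n) ε) ⟩
        b zero + length (subsets n) · ε
          <⟨ b₀+Nε<ℓ₀ ⟩
        ℓ zero ∎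

      mass≤bₛ : ∀ i h → Injective _≡_ _≡_ h → tupleMass (suc i) h c′ ≤ b (suc i)
      mass≤bₛ i h inj = begin
        tupleMass (suc i) h c′
          ≈⟨ split _ ⟩
        tupleMass (suc i) h c + tupleMass (suc i) h (push λ _ → ε)
          ≈⟨ +-congˡ (mass-push-suc (0<s (suc i)) i h (λ _ → ε)) ⟩
        tupleMass (suc i) h c + 0#
          ≈⟨ +-identityʳ _ ⟩
        tupleMass (suc i) h c
          ≤⟨ mass≤b (suc i) h inj ⟩
        b (suc i) ∎

      impossible : ¬ (∃[ i ] F i ⊂ Colouring.colour C i)
      impossible (i , Fᵢ⊂) with to (threshold i) Fᵢ⊂
      impossible (zero  , _) | h , inj , ℓ≤mass , _ =
        <⇒≱ (mass₀<ℓ₀ h inj) (≤-trans ℓ≤mass (≤-reflexive (mass-colour C zero h)))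
      impossible (suc i , _) | h , inj , ℓ≤mass , 0<mass with b<ℓ i
      ... | inj₁ b<ℓᵢ = <⇒≱ b<ℓᵢ (≤-trans ℓ≤mass
        (≤-trans (≤-reflexive (mass-colour C (suc i) h)) (mass≤bₛ i h inj)))
      -- With a zero threshold `ℓ≤mass` says nothing; the contradiction comes from strict positivity
      -- of the mass.
      ... | inj₂ b≤0  = <⇒≱ 0<mass
        (≤-trans (≤-reflexive (mass-colour C (suc i) h)) (≤-trans (mass≤bₛ i h inj) b≤0))

    -- Orders are shifted by one: Arrows a x is about k_{a+1,x}.

    Arrows : ℕ → ℝ → Set
    Arrows a x = Σ (0# < x) λ 0<x → k (suc a) x z<s 0<x ⟶ F

    ℓ₀≤ : ∀ {a x} → Arrows a x → ℓ zero ≤ x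
    ℓ₀≤ {a} {x} (0<x , arrow) = ≮⇒≥ λ x<ℓ₀ →
      no-arrow (push (val 𝐤)) b (λ As _ → push-nonNeg (nonNeg 𝐤) As)
        (λ A → ≤-reflexive (Eq.sym (total-push A (val 𝐤)))) mass≤b x<ℓ₀ (λ _ → inj₂ ≤-refl) arrow
      where
      open OnlyFirst {suc a} {r}

      𝐤 = k (suc a) x z<s 0<x

      b : Fin (suc r) → ℝ
      b zero    = x
      b (suc _) = 0#

      mass≤b : ∀ i (h : Fin (s i) → Fin (suc a)) → Injective _≡_ _≡_ h →
               tupleMass i h (push (val 𝐤)) ≤ b i
      mass≤b zero h _ = begin
        tupleMass zero h (push (val 𝐤))               ≤⟨ mass-push-zero h (nonNeg 𝐤) ⟩
        ∑ (subsets (suc a)) (val 𝐤)                    ≈⟨ ∑-cong (subsets (suc a)) (λ _ → *-identityˡ _) ⟨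
        ∑[ A ∈ subsets (suc a) ] (1# * val 𝐤 A)        ≈⟨ ∑-k {suc a} z<s 0<x (λ _ → 1#) ⟩
        1# * x                                         ≈⟨ *-identityˡ x ⟩
        x                                              ∎
      mass≤b (suc i) h _ = ≤-reflexive (mass-push-suc (0<s (suc i)) i h (val 𝐤))

    -- A common upper bound of the thresholds; the sum does duty for the maximum.
    Λ : ℝ
    Λ = ∑ (allFin (suc r)) ℓ

    ℓ≤Λ : ∀ i → ℓ i ≤ Λ
    ℓ≤Λ i = ≤∑ {f = ℓ} (λ {j} _ → 0≤ℓ (threshold j)) (∈-allFin i)

    0≤Λ : 0# ≤ Λ
    0≤Λ = ≤-trans (0≤ℓ (threshold zero)) (ℓ≤Λ zero)

    -- With more than Σ sᵢ points, some class of any covering tuple has at least sᵢ elements.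

    avoiding-total : ∀ {n} {g : Weight n} → ∑ⁿ s ℕ.< n → (C : Colouring (suc r) g) →
                     ¬ (∃[ i ] F i ⊂ Colouring.colour C i) →
                     tupleTotal ⊤ (Colouring.c C) ≤ ∑[ _ ∈ disjointTuples n (suc r) ] Λ
    avoiding-total {n} ∑s<n C avoids = ∑-mono (disjointTuples n (suc r)) λ {As} As∈ →
      𝟙*≤ (⋃ (toList As) ≟ ⊤) 0≤Λ λ ⋃≡⊤ →
        let i , s≤       = pigeonhole s As (ℕ.<-≤-trans ∑s<n
                             (ℕ.≤-reflexive (≡.sym (≡.trans (cong ∣_∣ ⋃≡⊤) (∣⊤∣≡n n)))))
            h , inj , h⊆ = injection-into (lookup As i) s≤
        in ≤-trans (c≤mass As∈ i h h⊆) (≤-trans (avoiding-mass C avoids i h inj) (ℓ≤Λ i))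
      where
      open Colouring C

      c≤mass : ∀ {As} → As ∈ˡ disjointTuples n (suc r) → ∀ i (h : Fin (s i) → Fin n) →
               h [ ⊤ ]⊆ lookup As i → c As ≤ tupleMass i h c
      c≤mass {As} As∈ i h h⊆ = begin
        c As
          ≈⟨ *-identityˡ (c As) ⟨
        1# * c As
          ≈⟨ *-congʳ (𝟙-yes (h [ ⊤ ]⊆? lookup As i) h⊆) ⟨
        𝟙 (h [ ⊤ ]⊆? lookup As i) * c As
          ≤⟨ ≤∑ {f = λ As → 𝟙 (h [ ⊤ ]⊆? lookup As i) * c As} (λ {Bs} Bs∈ →
               *-nonNeg (0≤𝟙 (h [ ⊤ ]⊆? lookup Bs i)) (c-nonNeg Bs (∈-disjointTuples⁻ Bs∈))) As∈ ⟩
        tupleMass i h c ∎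

    some-arrow : ∃₂ Arrows
    some-arrow = a , x , 0<x , λ C → decidable-stable em λ avoids →
      <⇒≱ (x<total C) (≤-trans (avoiding-total ℕ.≤-refl C avoids) (proj₁ (x<y+x 0<1)))
      where
      a : ℕ
      -- The shift of orders gives the weight one point more than this sum, as the pigeonhole
      -- principle requires.
      a = ∑ⁿ s

      x : ℝ
      -- In an avoiding colouring each tuple contributes at most `Λ` to the total at `⊤`, whereas
      -- covering forces that total above `x`. The summand `1#` gives positivity.
      x = 1# + (∑[ _ ∈ disjointTuples (suc a) (suc r) ] Λ)

      0<x : 0# < x
      0<x = <-≤-trans 0<1 (≤-trans (≤-reflexive (Eq.sym (+-identityʳ 1#)))
                                   (+-monoʳ-≤ 1# (0≤∑ (disjointTuples (suc a) (suc r)) λ _ → 0≤Λ)))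

      x<total : (C : Colouring (suc r) (k (suc a) x z<s 0<x)) → x < tupleTotal ⊤ (Colouring.c C)
      x<total = k-total z<s 0<x

    -- The covering condition is strict, hence a colouring avoiding F for k_{a,τ}
    -- also serves k_{a,x} for x slightly above τ.

    infimum-attained : ∀ {a x} → Arrows a x → ∃[ τ ] Arrows a τ × (∀ {y} → Arrows a y → τ ≤ y)
    infimum-attained {a} {x} ax = τ , (0<τ , arrow) , τ≤
      where
      LowerBound : ℝ → Set
      LowerBound = IsLowerBound (Arrows a)

      sup : ∃ (IsSupremum LowerBound)
      -- Completeness speaks of suprema, so the infimum arises as the supremum of the lower bounds,
      -- one of which is `ℓ zero`.
      sup = complete LowerBound (ℓ zero , ℓ₀≤) (x , λ lb → lb ax)

      τ = proj₁ sup

      τ≤ : ∀ {y} → Arrows a y → τ ≤ y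
      τ≤ ay = proj₂ (proj₂ sup) λ lb → lb ay

      0<τ : 0# < τ
      0<τ = <-≤-trans 0<ℓ₀ (proj₁ (proj₂ sup) ℓ₀≤)

      arrow : k (suc a) τ z<s 0<τ ⟶ F
      arrow C = decidable-stable em λ avoids →
        <⇒≱ (k-total z<s 0<τ C) (proj₁ (proj₂ sup) (total-lowerBound C avoids))
        where
        total-lowerBound : (C : Colouring (suc r) (k (suc a) τ z<s 0<τ)) →
                           ¬ (∃[ i ] F i ⊂ Colouring.colour C i) →
                           LowerBound (tupleTotal ⊤ (Colouring.c C))
        total-lowerBound C avoids (0<y , y⟶F) = ≮⇒≥ λ y<total →
          avoids (y⟶F (k-recolour z<s 0<τ 0<y C y<total))

    Bound : ℝ → ℕ → Set
    Bound v b = ∀ {y} → Arrows b y → v ≤ suc b · y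

    bound-suc : ∀ {v N} → (∀ {b} → b ℕ.< N → Bound v b) → Bound v N →
                ∀ {b} → b ℕ.< suc N → Bound v b
    bound-suc below at-N (s≤s b≤N) with ℕ.m≤n⇒m<n∨m≡n b≤N
    ... | inj₁ b<N  = below b<N
    ... | inj₂ refl = at-N

    -- The current candidate is compared with the attained infimum at order `N`, and the smaller
    -- size is kept. If nothing of order `N` arrows, the bound holds vacuously.
    minimum-at : ∀ N {a x} → Arrows a x →
                 ∃₂ λ b y → Arrows b y × suc b · y ≤ suc a · x × Bound (suc b · y) N
    minimum-at N {a} {x} ax with em {∃ (Arrows N)}
    ... | no  none     = a , x , ax , ≤-refl , λ Ny → contradiction (_ , Ny) none
    ... | yes (_ , Ny) with τ , Nτ , τ≤ ← infimum-attained Ny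
                       with ≤-total (suc a · x) (suc N · τ)
    ...   | inj₁ ax≤Nτ = a , x , ax , ≤-refl , λ Ny →
      ≤-trans ax≤Nτ (·-mono-≤ {suc N} ℕ.≤-refl (proj₁ (proj₁ Ny)) (τ≤ Ny))
    ...   | inj₂ Nτ≤ax = N , τ , Nτ , Nτ≤ax , λ Ny →
      ·-mono-≤ {suc N} ℕ.≤-refl (proj₁ (proj₁ Ny)) (τ≤ Ny)

    minimum-below : ∀ N {a x} → Arrows a x →
                    ∃₂ λ b y → Arrows b y × suc b · y ≤ suc a · x ×
                    (∀ {d} → d ℕ.< N → Bound (suc b · y) d)
    minimum-below zero    {a} {x} ax = a , x , ax , ≤-refl , λ ()
    minimum-below (suc N) ax =
      let b , y , by , by≤ax , below = minimum-below N ax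
          d , z , dz , dz≤by , at-N  = minimum-at N by
      in  d , z , dz , ≤-trans dz≤by by≤ax
        , bound-suc (λ b<N bw → ≤-trans dz≤by (below b<N bw)) at-N

    -- Since Arrows b y forces y ≥ ℓ₀, only finitely many orders compete for the minimum.

    minimum : ∃₂ λ a x → Arrows a x × (∀ {b} → Bound (suc a · x) b)
    minimum =
      let a , x , ax = some-arrow
          N , ax<Nℓ₀ = archimedean 0<ℓ₀ (suc a · x)
          d , z , dz , dz≤ax , below = minimum-below N ax
      in  d , z , dz , λ {b} {y} by → [ (λ b<N → below b<N by)
        , (λ N≤b → ≤-trans dz≤ax (≤-trans (proj₁ ax<Nℓ₀)
            (·-mono-≤ {N} {suc b} (ℕ.m≤n⇒m≤1+n N≤b) (proj₁ (proj₁ by)) (ℓ₀≤ by)))) ]′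
      (ℕ.<-≤-connex b N)

    -- Averaging avoiding colourings over the sets of an arbitrary weight.

    module Combination {M M′ ρ} (M≤ : ∀ {b} → Bound M b) (M′<M : M′ < M)
                       (0<ρ : 0# < ρ) (M′ρ≈1 : M′ * ρ ≈ 1#)
                       {n} (g : Weight n) (e<M′ : size g < M′) where

      0≤ρℓ : ∀ i → 0# ≤ ρ * ℓ i
      0≤ρℓ i = *-nonNeg (proj₁ 0<ρ) (0≤ℓ (threshold i))

      -- A colouring of k_{a,M′/a} avoiding F, divided by M′/a = (a · ρ)⁻¹.

      record Normalised (a : ℕ) : Set where
        field
          c        : Vec (Subset a) (suc r) → ℝ
          c-nonNeg : ∀ As → PairwiseDisjoint As → 0# ≤ c As
          1≤total  : 1# ≤ tupleTotal ⊤ c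
          mass≤    : ∀ i (h : Fin (s i) → Fin a) → Injective _≡_ _≡_ h →
                     tupleMass i h c ≤ a · (ρ * ℓ i)

      -- Without points no map from the nonempty [sᵢ] exists, so the mass bounds are vacuous and one
      -- unit in the first colour covers the empty set.
      normalised-empty : ∀ a → ¬ Fin a → Normalised a
      normalised-empty a empty = record
        { c        = push (λ _ → 1#)
        ; c-nonNeg = λ As _ → push-nonNeg (λ _ → 0≤1) As
        ; 1≤total  = ≤-reflexive (Eq.sym (total-push ⊤ (λ _ → 1#)))
        ; mass≤    = λ i h → contradiction (h (Fin.fromℕ< (0<s i))) empty
        }
        where open OnlyFirst {a} {r}

      -- As ρ is 1/M′, the hypothesis says x = M′/a. Dividing by `x` raises the total to at least 1
      -- and turns the mass bound `ℓ i` into one proportional to `a`; this proportionality is what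
      -- makes `size g` appear when the copies are added up.
      normalise : ∀ {a x} (0<a : 0 ℕ.< a) (0<x : 0# < x) → (a · ρ) * x ≈ 1# →
                  (C : Colouring (suc r) (k a x 0<a 0<x)) →
                  ¬ (∃[ i ] F i ⊂ Colouring.colour C i) → Normalised a
      normalise {a} {x} 0<a 0<x yx≈1 C avoids = record
        { c        = λ As → y * c As
        ; c-nonNeg = λ As disj → *-nonNeg 0≤y (c-nonNeg As disj)
        ; 1≤total  = begin
            1#                               ≈⟨ yx≈1 ⟨
            y * x                            ≤⟨ *-monoˡ-≤ 0≤y (proj₁ (k-total 0<a 0<x C)) ⟩
            y * tupleTotal ⊤ c               ≈⟨ scale (λ As → 𝟙 (⋃ (toList As) ≟ ⊤)) ⟨
            tupleTotal ⊤ (λ As → y * c As)   ∎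
        ; mass≤    = λ i h inj → begin
            tupleMass i h (λ As → y * c As)  ≈⟨ scale (λ As → 𝟙 (h [ ⊤ ]⊆? lookup As i)) ⟩
            y * tupleMass i h c              ≤⟨ *-monoˡ-≤ 0≤y (avoiding-mass C avoids i h inj) ⟩
            y * ℓ i                          ≈⟨ ×-assoc-* a ρ (ℓ i) ⟩
            a · (ρ * ℓ i)                    ∎
        }
        where
        open Colouring C

        y : ℝ
        y = a · ρ

        0≤y : 0# ≤ y
        0≤y = ·-nonNeg a (proj₁ 0<ρ)

        scale : ∀ f → tupleSum f (λ As → y * c As) ≈ y * tupleSum f c
        scale f = Eq.trans
          (∑-cong (disjointTuples a (suc r)) λ {As} _ → x*yz≈y*xz (f As) y (c As))
          (Eq.sym (*-distribˡ-∑ (disjointTuples a (suc r)) y (λ As → f As * c As)))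

      a·x≈M′ : ∀ a {x} → (a · ρ) * x ≈ 1# → a · x ≈ M′
      a·x≈M′ a {x} yx≈1 = begin-equality
        a · x               ≈⟨ *-identityˡ _ ⟨
        1# * (a · x)        ≈⟨ *-congʳ M′ρ≈1 ⟨
        M′ * ρ * (a · x)    ≈⟨ *-assoc M′ ρ _ ⟩
        M′ * (ρ * (a · x))  ≈⟨ *-congˡ (×-comm-* a ρ x) ⟩
        M′ * (a · (ρ * x))  ≈⟨ *-congˡ (×-assoc-* a ρ x) ⟨
        M′ * ((a · ρ) * x)  ≈⟨ *-congˡ yx≈1 ⟩
        M′ * 1#             ≈⟨ *-identityʳ M′ ⟩
        M′                  ∎

      -- Otherwise every colouring of `k` of size M′ would contain some target, so this `k` would
      -- arrow, against the lower bound `M`.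
      normalised-suc : ∀ a → Normalised (suc a)
      normalised-suc a =
        let x , 0<x , yx≈1 = inverse⁺ (·-pos {suc a} z<s 0<ρ) in
        decidable-stable em λ none →
          <⇒≱ (≤-<-trans (≤-reflexive (a·x≈M′ (suc a) yx≈1)) M′<M)
              (M≤ {a} (0<x , λ C → decidable-stable em λ avoids →
              none (normalise z<s 0<x yx≈1 C avoids)))

      normalised : ∀ a → Normalised a
      normalised zero    = normalised-empty 0 λ ()
      normalised (suc a) = normalised-suc a

      module _ (A : Subset n) where
        open Normalised (normalised ∣ A ∣) renaming (c to cᴬ) public
        open Pushforward (≡-dec _≟_) {xs = disjointTuples ∣ A ∣ (suc r)} (disjointTuples-unique n (suc r))
          (Vec.map (image (elements A)))
          (λ Bs∈ → ∈-disjointTuples⁺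
            (images-disjoint (elements A) (elements-injective A) (∈-disjointTuples⁻ Bs∈)))
          renaming (push to pushᴬ; ∑-push to ∑-pushᴬ) public

        transported : Vec (Subset n) (suc r) → ℝ
        transported = pushᴬ cᴬ

        transported-nonNeg : ∀ As → 0# ≤ transported As
        transported-nonNeg As = 0≤∑ (disjointTuples ∣ A ∣ (suc r)) λ {Bs} Bs∈ →
          *-nonNeg (0≤𝟙 (≡-dec _≟_ (Vec.map (image (elements A)) Bs) As))
                   (c-nonNeg Bs (∈-disjointTuples⁻ Bs∈))

        1≤transported-total : 1# ≤ tupleTotal A transported
        1≤transported-total = begin
          1#
            ≤⟨ 1≤total ⟩
          tupleTotal ⊤ cᴬ
            ≤⟨ tupleSum-mono c-nonNeg (λ Bs →
                 𝟙-mono (⋃ (toList Bs) ≟ ⊤) (⋃ (toList (Vec.map (image (elements A)) Bs)) ≟ A)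
                        (⋃-images A Bs)) ⟩
          tupleSum (λ Bs → 𝟙 (⋃ (toList (Vec.map (image (elements A)) Bs)) ≟ A)) cᴬ
            ≈⟨ ∑-pushᴬ (λ As → 𝟙 (⋃ (toList As) ≟ A)) cᴬ ⟨
          tupleTotal A transported ∎

        -- A map into `A` is pulled back to the colouring that was copied; a map that leaves `A`
        -- gets nothing, because all classes of the copied tuples lie in `A`.
        transported-mass : ∀ i (h : Fin (s i) → Fin n) → Injective _≡_ _≡_ h →
                           tupleMass i h transported ≤ ∣ A ∣ · (ρ * ℓ i)
        transported-mass i h inj = ≤-trans
          (≤-reflexive (∑-pushᴬ (λ As → 𝟙 (h [ ⊤ ]⊆? lookup As i)) cᴬ))
          (bound (factor (elements A) h inj))
          where
          bound : (∃[ h′ ] Injective _≡_ _≡_ h′ × (∀ j → elements A (h′ j) ≡ h j)) ⊎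
                  (∀ {B} → ¬ h [ ⊤ ]⊆ image (elements A) B) →
                  tupleSum (λ Bs → 𝟙 (h [ ⊤ ]⊆? lookup (Vec.map (image (elements A)) Bs) i)) cᴬ ≤
                  ∣ A ∣ · (ρ * ℓ i)
          bound (inj₁ (h′ , inj′ , eq)) = ≤-trans
            (tupleSum-mono c-nonNeg λ Bs →
              𝟙-mono (h [ ⊤ ]⊆? lookup (Vec.map (image (elements A)) Bs) i) (h′ [ ⊤ ]⊆? lookup Bs i)
                (⊆-image⁻ (elements A) (elements-injective A) eq
                  ∘ subst (h [ ⊤ ]⊆_) (lookup-map i (image (elements A)) Bs)))
            (mass≤ i h′ inj′)
          bound (inj₂ h⊈) = ≤-trans
            (≤-reflexive (∑-0 (disjointTuples ∣ A ∣ (suc r)) λ {Bs} _ → Eq.trans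
              (*-congʳ (𝟙-no (h [ ⊤ ]⊆? lookup (Vec.map (image (elements A)) Bs) i)
                (h⊈ ∘ subst (h [ ⊤ ]⊆_) (lookup-map i (image (elements A)) Bs)))) (zeroˡ _)))
            (·-nonNeg ∣ A ∣ (0≤ρℓ i))

      combined : Vec (Subset n) (suc r) → ℝ
      combined As = ∑[ A ∈ subsets n ] (val g A * transported A As)

      combined-sum : ∀ f → tupleSum f combined ≈ ∑[ A ∈ subsets n ] (val g A * tupleSum f (transported A))
      combined-sum f = ∑-linear (disjointTuples n (suc r)) (subsets n) f (val g) transported

      covers : ∀ A → val g A ≤ tupleTotal A combined
      covers A = begin
        val g A
          ≈⟨ *-identityʳ _ ⟨
        val g A * 1#
          ≤⟨ *-monoˡ-≤ (nonNeg g A) (1≤transported-total A) ⟩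
        val g A * tupleTotal A (transported A)
          -- The copy on `A` itself already covers `A`; the other copies only add non-negative
          -- terms.
          ≤⟨ ≤∑ {f = λ B → val g B * tupleTotal A (transported B)} (λ {B} _ → *-nonNeg (nonNeg g B)
               (0≤∑ (disjointTuples n (suc r)) λ {As} _ →
                 *-nonNeg (0≤𝟙 (⋃ (toList As) ≟ A)) (transported-nonNeg B As))) (∈-subsets A) ⟩
        ∑[ B ∈ subsets n ] (val g B * tupleTotal A (transported B))
          ≈⟨ combined-sum (λ As → 𝟙 (⋃ (toList As) ≟ A)) ⟨
        tupleTotal A combined ∎

      combined-mass : ∀ i (h : Fin (s i) → Fin n) → Injective _≡_ _≡_ h →
                      tupleMass i h combined ≤ size g * (ρ * ℓ i)
      combined-mass i h inj = begin
        tupleMass i h combined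
          ≈⟨ combined-sum (λ As → 𝟙 (h [ ⊤ ]⊆? lookup As i)) ⟩
        ∑[ A ∈ subsets n ] (val g A * tupleMass i h (transported A))
          ≤⟨ ∑-mono (subsets n) (λ {A} _ → *-monoˡ-≤ (nonNeg g A) (transported-mass A i h inj)) ⟩
        ∑[ A ∈ subsets n ] (val g A * (∣ A ∣ · (ρ * ℓ i)))
          ≈⟨ ∑-cong (subsets n) (λ {A} _ → begin-equality
               val g A * (∣ A ∣ · (ρ * ℓ i))  ≈⟨ ×-comm-* ∣ A ∣ (val g A) (ρ * ℓ i) ⟩
               ∣ A ∣ · (val g A * (ρ * ℓ i))  ≈⟨ ×-assoc-* ∣ A ∣ (val g A) (ρ * ℓ i) ⟨
               (∣ A ∣ · val g A) * (ρ * ℓ i)  ≈⟨ *-comm _ (ρ * ℓ i) ⟩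
               (ρ * ℓ i) * (∣ A ∣ · val g A)  ∎) ⟩
        ∑[ A ∈ subsets n ] ((ρ * ℓ i) * (∣ A ∣ · val g A))
          ≈⟨ *-distribˡ-∑ (subsets n) (ρ * ℓ i) (λ A → ∣ A ∣ · val g A) ⟨
        (ρ * ℓ i) * size g
          ≈⟨ *-comm _ (size g) ⟩
        size g * (ρ * ℓ i) ∎

      shrunk : ∀ {x} → 0# < x → size g * (ρ * x) < x
      shrunk {x} 0<x = begin-strict
        size g * (ρ * x)         ≈⟨ +-identityˡ _ ⟨
        0# + size g * (ρ * x)    <⟨ +-monoˡ-< _ (*-pos (0<y-x e<M′) (*-pos 0<ρ 0<x)) ⟩
        (M′ + - size g) * (ρ * x) + size g * (ρ * x)  ≈⟨ distribʳ (ρ * x) _ (size g) ⟨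
        (M′ + - size g + size g) * (ρ * x)  ≈⟨ *-congʳ (x-y+y≈x M′ (size g)) ⟩
        M′ * (ρ * x)             ≈⟨ *-assoc M′ ρ x ⟨
        M′ * ρ * x               ≈⟨ *-congʳ M′ρ≈1 ⟩
        1# * x                   ≈⟨ *-identityˡ x ⟩
        x                        ∎

      -- Scaling by e(g)/M′ < 1 strictly lowers a positive threshold; at threshold zero nothing can
      -- drop, but the bound is then zero itself.
      shrunk⊎≤0 : ∀ i → size g * (ρ * ℓ i) < ℓ i ⊎ size g * (ρ * ℓ i) ≤ 0#
      shrunk⊎≤0 i with em {0# < ℓ i}
      ... | yes 0<ℓ = inj₁ (shrunk 0<ℓ)
      ... | no  0≮ℓ = inj₂ (begin
        size g * (ρ * ℓ i)  ≤⟨ *-monoˡ-≤ (size-nonNeg g) (*-monoˡ-≤ (proj₁ 0<ρ) (≮⇒≥ 0≮ℓ)) ⟩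
        size g * (ρ * 0#)   ≈⟨ *-congˡ (zeroʳ ρ) ⟩
        size g * 0#         ≈⟨ zeroʳ _ ⟩
        0#                  ∎)

      g↛F : ¬ (g ⟶ F)
      g↛F = no-arrow combined (λ i → size g * (ρ * ℓ i))
        (λ As _ → 0≤∑ (subsets n) λ {A} _ → *-nonNeg (nonNeg g A) (transported-nonNeg A As))
        covers combined-mass (shrunk 0<ℓ₀) (shrunk⊎≤0 ∘ suc)

    size-bound : ∀ {M n} {g : Weight n} → (∀ {b} → Bound M b) → g ⟶ F → M ≤ size g
    size-bound {g = g} M≤ g⟶F = ≮⇒≥ λ e<M →
      -- Both gaps are used: M′ < M provides the avoiding colourings, and `size g` < M′ makes the
      -- scaling factor smaller than 1.
      let M′ , e<M′ , M′<M = dense e<M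
          ρ , 0<ρ , M′ρ≈1  = inverse⁺ (≤-<-trans (size-nonNeg g) e<M′)
      in Combination.g↛F M≤ M′<M 0<ρ M′ρ≈1 g e<M′ g⟶F

    extremal : Σ ℕ λ s₀ → Σ ℝ λ t₀ → Σ (0 ℕ.< s₀) λ 0<s₀ → Σ (0# < t₀) λ 0<t₀ →
               (k s₀ t₀ 0<s₀ 0<t₀ ⟶ F) × (r̂ F ≐ size (k s₀ t₀ 0<s₀ 0<t₀)) ×
               (size (k s₀ t₀ 0<s₀ 0<t₀) ≈ s₀ · t₀)
    extremal =
      let a , x , (0<x , k⟶F) , least = minimum in
      suc a , x , z<s , 0<x , k⟶F
      , ( (λ { (n , g , g⟶F , y≈size) → ≤-trans (≤-reflexive (size-k {suc a} z<s 0<x))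
               (≤-trans (size-bound least g⟶F) (≤-reflexive (Eq.sym y≈size))) })
        , λ lb → lb (suc a , k (suc a) x z<s 0<x , k⟶F , Eq.refl))
      , size-k {suc a} z<s 0<x

theorem6 : ExcludedMiddle 0ℓ →
    (R : CompleteOrderedField) →
    let open CompleteOrderedField R
        open Weights R in
    (q p : ℕ) → 2 ℕ.≤ q ℕ.+ p → 1 ℕ.≤ q →
    (s : Fin (q ℕ.+ p) → ℕ) (t : Fin q → ℝ) (u : Fin p → ℕ) →
    (0<s : ∀ i → 0 ℕ.< s i) (0<t : ∀ i → 0# < t i) → (∀ j → 0 ℕ.< u j) →
    (∀ j → s (q ↑ʳ j) ℕ.≤ u j) →
    let 𝐅 = family q p s t u 0<s 0<t in
    Σ ℕ λ s₀ → Σ ℝ λ t₀ → Σ (0 ℕ.< s₀) λ 0<s₀ → Σ (0# < t₀) λ 0<t₀ →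
    let 𝐤 = k s₀ t₀ 0<s₀ 0<t₀ in
    (𝐤 ⟶ 𝐅) × (r̂ 𝐅 ≐ size 𝐤) × (size 𝐤 ≈ s₀ · t₀)
-- Since `q` is at least 1, the first target is a weight, and `0<t zero` is the positivity of its
-- threshold.
theorem6 em R (suc q) p _ _ s t u 0<s 0<t 0<u s≤u =
  Family.extremal (family (suc q) p s t u 0<s 0<t) s ℓ 0<s (0<t zero) threshold
  where
  open Arrowing em R
  open CompleteOrderedField R using (0#)
  open Weights R

  ℓ : Fin (suc q ℕ.+ p) → ℝ
  ℓ i = [ t , const 0# ]′ (Fin.splitAt (suc q) i)

  threshold : ∀ i → Threshold (family (suc q) p s t u 0<s 0<t i) (s i) (ℓ i)
  threshold i with Fin.splitAt (suc q) i in eq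
  ... | inj₁ j with refl ← Fin.splitAt⁻¹-↑ˡ {i = i} eq = k-threshold (0<s i) (0<t j)
  ... | inj₂ j with refl ← Fin.splitAt⁻¹-↑ʳ {suc q} {i = i} eq = K-threshold (0<s i) (0<u j) (s≤u j)
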